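{- Let $k\ge1$, $c,r\ge1$ with $c+r=k+1$, $R=(c^r)$, and let $\nu$ be a partition contained in $R$. Then $${\bf u}\big(V_{(R,\nu)/\nu}\big)=\tilde v_{\phi(\nu)}.$$ Consequently $\sum_{\nu\subseteq R}{\bf u}(V_{(R,\nu)/\nu})=Z_R:=\sum_{A}\tilde v_A$, the last sum over all $c$-element subsets $A$ of $\{0,1,\dots,k\}$.
   Context: Indices are modulo $k+1$. $W$ is the affine symmetric group with generators $s_0,\dots,s_k$ (relations $s_i^2=1$, $s_is_j=s_js_i$ for $i-j\not\equiv\pm1$, $s_is_{i+1}s_i=s_{i+1}s_is_{i+1}$); $\mathbb{A}$ is the affine nilCoxeter algebra with generators $u_0,\dots,u_k$ (relations $u_i^2=0$ and the same commutation and braid relations); for $w\in W$ with reduced word $s_{i_1}\cdots s_{i_m}$, ${\bf u}(w)=u_{i_1}\cdots u_{i_m}$. The content of the box in row $i$, column $j$ is $(j-i)\bmod(k+1)$. For a skew shape $\nu/\mu$, $V_{\nu/\mu}\in W$ is the product of $s_{\text{content}}$ over its boxes read row by row from the last (highest-indexed) row to row 1, each row right to left. For $\nu\subseteq R$, $(R,\nu)=(c,\dots,c,\nu_1,\nu_2,\dots)$ ($r$ copies of $c$). For a proper subset $D\subsetneq\{0,\dots,k\}$, $u_D\in\mathbb{A}$ is the product of the $u_m$, $m\in D$, each once, ordered so that whenever $j,j+1\in D$ (mod $k+1$), $u_{j+1}$ occurs left of $u_j$. For $A\subseteq\{0,\dots,k\}$ with $|A|=c$, let $A+d=\{i+d \bmod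 (k+1): i\in A\}$ and $\tilde v_A=u_Au_{A+1}u_{A+2}\cdots u_{A+r-1}$. For $\nu\subseteq R$, set $\nu_0=c$ and $\nu_d=0$ for $d$ larger than the number of parts of $\nu$, and $$\phi(\nu)=\bigcup_{j=0}^{r}\{\,i \bmod (k+1):\ \nu_{r-j}-2r+1+j> i\ge \nu_{r-j+1}-2r+1+j\,\}.$$ -}

module Defs where

open import Data.Nat as ℕ using (ℕ; zero; suc; _∸_; _≤_; _<_; NonZero)
open import Data.Integer as ℤ using (ℤ; +_; _-_; _⊔_; ∣_∣; 0ℤ; 1ℤ; -1ℤ)
open import Data.Integer.DivMod using (_%ℕ_; n%ℕd<d)
open import Data.Fin as Fin using (Fin; toℕ; fromℕ<)
open import Data.Fin.Subset using (Subset; ⁅_⁆; _∪_; _∉_) renaming (⊥ to ∅; _∈_ to _∈ₛ_)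
open import Data.List using (List; []; _∷_; _++_; map; concat; upTo; reverse; length; foldr; lookup; replicate)
open import Data.List.Properties using (≡-dec)
open import Data.List.Membership.Propositional using (_∈_)
open import Data.List.Relation.Unary.Unique.Propositional using (Unique)
open import Data.Vec as Vec using (Vec; tabulate)
open import Data.Product using (Σ; ∃-syntax; _×_; _,_)
open import Data.Sum using (_⊎_)
open import Relation.Nullary using (¬_; yes; no)
open import Relation.Binary.PropositionalEquality using (_≡_)

intMod : (n : ℕ) .{{_ : NonZero n}} → ℤ → Fin n
intMod n i = fromℕ< (n%ℕd<d i n)

next : (n : ℕ) .{{_ : NonZero n}} → Fin n → Fin n
next n j = intMod n (+ toℕ j ℤ.+ 1ℤ)

Adjacent : (n : ℕ) .{{_ : NonZero n}} → Fin n → Fin n → Set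
Adjacent n i j = (j ≡ next n i) ⊎ (i ≡ next n j)

-- The affine symmetric group W (generators s_0..s_k, n = k+1), via words.
-- Braid relations s_i s_{i+1} s_i = s_{i+1} s_i s_{i+1} are imposed for k ≥ 2
-- (for k = 1 the affine symmetric group is infinite dihedral: no braid relation).

data WStep (k : ℕ) : List (Fin (suc k)) → List (Fin (suc k)) → Set where
  w-sq    : (i : Fin (suc k)) → WStep k (i ∷ i ∷ []) []
  w-comm  : (i j : Fin (suc k)) → ¬ Adjacent (suc k) i j → WStep k (i ∷ j ∷ []) (j ∷ i ∷ [])
  w-braid : 2 ≤ k → (i : Fin (suc k)) →
            WStep k (i ∷ next (suc k) i ∷ i ∷ []) (next (suc k) i ∷ i ∷ next (suc k) i ∷ [])

data _∼W_ {k : ℕ} : List (Fin (suc k)) → List (Fin (suc k)) → Set where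
  ∼refl  : ∀ {x} → x ∼W x
  ∼sym   : ∀ {x y} → x ∼W y → y ∼W x
  ∼trans : ∀ {x y z} → x ∼W y → y ∼W z → x ∼W z
  ∼step  : ∀ p q {a b} → WStep k a b → (p ++ a ++ q) ∼W (p ++ b ++ q)

IsReducedWordOf : {k : ℕ} → List (Fin (suc k)) → List (Fin (suc k)) → Set
IsReducedWordOf {k} x y = (x ∼W y) × (∀ z → z ∼W y → length x ≤ length z)

-- The affine nilCoxeter algebra 𝔸 = ℤ⟨u_0..u_k⟩ / I.
-- Elements of the free algebra: formal ℤ-linear combinations of words.

FA : ℕ → Set
FA n = List (ℤ × List (Fin n))

sumℤ : List ℤ → ℤ
sumℤ = foldr ℤ._+_ 0ℤ

coeff : {n : ℕ} → FA n → List (Fin n) → ℤ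
coeff f w = sumℤ (map (λ { (c , w') → sel c w' }) f)
  where
  sel : ℤ → List (Fin _) → ℤ
  sel c w' with ≡-dec Fin._≟_ w' w
  ... | yes _ = c
  ... | no  _ = 0ℤ

data NilRel (k : ℕ) : FA (suc k) → Set where
  n-sq    : (i : Fin (suc k)) → NilRel k ((1ℤ , i ∷ i ∷ []) ∷ [])
  n-comm  : (i j : Fin (suc k)) → ¬ Adjacent (suc k) i j →
            NilRel k ((1ℤ , i ∷ j ∷ []) ∷ (-1ℤ , j ∷ i ∷ []) ∷ [])
  n-braid : 2 ≤ k → (i : Fin (suc k)) →
            NilRel k ((1ℤ , i ∷ next (suc k) i ∷ i ∷ []) ∷
                      (-1ℤ , next (suc k) i ∷ i ∷ next (suc k) i ∷ []) ∷ [])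

idealSum : {k : ℕ} → List (ℤ × List (Fin (suc k)) × Σ (FA (suc k)) (NilRel k) × List (Fin (suc k))) → FA (suc k)
idealSum L = concat (map (λ { (c , p , (r , _) , q) → map (λ { (d , w) → (c ℤ.* d , p ++ w ++ q) }) r }) L)

_≈𝔸_ : {k : ℕ} → FA (suc k) → FA (suc k) → Set
_≈𝔸_ {k} f g = ∃[ L ] (∀ w → coeff f w - coeff g w ≡ coeff (idealSum {k} L) w)

mono : {n : ℕ} → List (Fin n) → FA n
mono w = (1ℤ , w) ∷ []

sumMonos : {n : ℕ} → List (List (Fin n)) → FA n
sumMonos ws = map (λ w → (1ℤ , w)) ws

Proper : {n : ℕ} → Subset n → Set
Proper D = ∃[ m ] (m ∉ D)

IsUOrder : (n : ℕ) .{{_ : NonZero n}} → Subset n → List (Fin n) → Set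
IsUOrder n D w =
  Unique w × (∀ m → (m ∈ w → m ∈ₛ D) × (m ∈ₛ D → m ∈ w)) ×
  (∀ (p q : Fin (length w)) → lookup w q ≡ next n (lookup w p) → q Fin.< p)

shift : (n : ℕ) .{{_ : NonZero n}} → Subset n → ℕ → Subset n
shift n A d = tabulate (λ m → Vec.lookup A (intMod n (+ toℕ m - + d)))

-- ṽ_A = u_A u_{A+1} ⋯ u_{A+r-1}, where σ D is a word realising u_D
vtilde : (k : ℕ) → (Subset (suc k) → List (Fin (suc k))) → ℕ → Subset (suc k) → List (Fin (suc k))
vtilde k σ r A = concat (map (λ d → σ (shift (suc k) A d)) (upTo r))

-- Partitions ν ⊆ R = (c^r), stored as Vec ℕ r = (ν_1,…,ν_r) (padded with 0s)

InBox : (c r : ℕ) → Vec ℕ r → Set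
InBox c r ν = (∀ i → Vec.lookup ν i ≤ c) ×
              (∀ (i j : Fin r) → i Fin.≤ j → Vec.lookup ν j ≤ Vec.lookup ν i)

-- 1-based entry of a list of row lengths, 0 beyond the end
at : List ℕ → ℕ → ℕ
at []       _             = 0
at (x ∷ xs) zero          = 0
at (x ∷ xs) (suc zero)    = x
at (x ∷ xs) (suc (suc i)) = at xs (suc i)

content : (k : ℕ) → ℕ → ℕ → Fin (suc k)
content k i j = intMod (suc k) (+ j - + i)

rowWord : (k : ℕ) → ℕ → ℕ → ℕ → List (Fin (suc k))
rowWord k i li mi = map (λ t → content k i (li ∸ t)) (upTo (li ∸ mi))

readWord : (k : ℕ) → List ℕ → List ℕ → List (Fin (suc k))
readWord k λs μs =
  concat (map (λ i → rowWord k i (at λs i) (at μs i)) (reverse (map suc (upTo (length λs)))))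

RNu : (c r : ℕ) → Vec ℕ r → List ℕ
RNu c r ν = replicate r c ++ Vec.toList ν

Vword : (k c r : ℕ) → Vec ℕ r → List (Fin (suc k))
Vword k c r ν = readWord k (RNu c r ν) (Vec.toList ν)

-- ν_d with ν_0 = c and ν_d = 0 for d > r
part : (c r : ℕ) → Vec ℕ r → ℕ → ℕ
part c r ν zero    = c
part c r ν (suc d) = at (Vec.toList ν) (suc d)

interval : ℤ → ℤ → List ℤ
interval b a = map (λ t → b ℤ.+ + t) (upTo ∣ (a - b) ⊔ 0ℤ ∣)

toSubset : {n : ℕ} → List (Fin n) → Subset n
toSubset = foldr (λ x s → ⁅ x ⁆ ∪ s) ∅

phi : (k c r : ℕ) → Vec ℕ r → Subset (suc k)
phi k c r ν = toSubset (concat (map block (upTo (suc r))))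
  where
  block : ℕ → List (Fin (suc k))
  block j = map (intMod (suc k))
    (interval (+ part c r ν (suc (r ∸ j)) - + (2 ℕ.* r) ℤ.+ 1ℤ ℤ.+ + j)
              (+ part c r ν (r ∸ j) - + (2 ℕ.* r) ℤ.+ 1ℤ ℤ.+ + j))

{-# OPTIONS --safe #-}

-- Read a word from left to right as a particle process on the ring ℤ/(k+1): the letter i exchanges the
-- contents of the sites i and i+1, and the move is legal if it takes a particle from i to an empty site i+1.
-- The signed flux of particles through each bond is unchanged by all relations of W, and the total flux of a
-- word is at most its length, with equality exactly for legal words.  Hence a reduced word of an element that
-- has one legal word is itself legal and has the same letter counts; and two legal words from the same state
-- with the same letter counts are related by commutations alone, because distinct legal moves never touch.
--
-- Started from the particle set A = φ(ν), both the reading word of (R,ν)/ν and ṽ_A are legal.  In ṽ_A every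
-- factor u_{A+d} moves all particles one step.  In the reading word every row moves a single hole: the box
-- rows of ν bring the hole of row i to the bottom of the window, the rows of R/ν carry it on around the ring.
-- Both words have length c r and end in A + r, and by conservation of particles this forces equal letter counts.
-- The summed identity follows since ν ↦ φ(ν) is a bijection onto the c-subsets: the holes of φ(ν), in
-- decreasing order, sit at ν_i + r − i relative to 1 − 2r.

module Submission where

open import Defs
open import Data.Nat using (ℕ; suc; _≤_; _+_)
open import Data.Fin using (Fin)
open import Data.Fin.Subset using (Subset; ∣_∣)
open import Data.List using (List; map)
open import Data.List.Membership.Propositional using (_∈_)
open import Data.List.Relation.Unary.Unique.Propositional using (Unique)
open import Data.Vec using (Vec)
open import Data.Product using (_×_)
open import Relation.Binary.PropositionalEquality using (_≡_)

open import Data.Nat as ℕ using (zero; _<_; _*_; _∸_; z≤n; s≤s)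
import Data.Nat.Properties as ℕₚ
open import Data.Nat.Induction using (<-rec)
open import Data.Nat.Tactic.RingSolver using () renaming (solve-∀ to ℕ-solve-∀)
open import Algebra.Properties.CommutativeSemigroup ℕₚ.+-commutativeSemigroup
  using (x∙yz≈y∙xz; xy∙z≈xz∙y; interchange)
open import Data.Integer as ℤ using (ℤ; +_; -[1+_]; 0ℤ; 1ℤ; -1ℤ)
import Data.Integer.Properties as ℤₚ
open import Data.Integer.DivMod using (_%ℕ_; _/ℕ_; n%ℕd<d; a≡a%ℕn+[a/ℕn]*n)
open import Data.Integer.Tactic.RingSolver using (solve-∀)
open import Algebra.Properties.AbelianGroup ℤₚ.+-0-abelianGroup using (∙-cancelˡ)
open import Data.Bool as Bool using (Bool; true; false)
open import Data.Fin as Fin using (toℕ; fromℕ<; _≟_)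
import Data.Fin.Properties as Finₚ
open import Data.Fin.Subset using (∁; _∉_) renaming (_∈_ to _∈ₛ_)
open import Data.Fin.Subset.Properties
  using (x∈p∪q⁺; x∈p∪q⁻; x∈⁅x⁆; x∈⁅y⁆⇒x≡y; ∉⊥; ∣∁p∣≡n∸∣p∣; ∣p∣≤n; x∈∁p⇒x∉p; x∉p⇒x∈∁p)
open import Data.List as List
  using ([]; _∷_; _++_; length; concat; applyUpTo; applyDownFrom; upTo; downFrom; reverse; replicate; filter)
open import Data.List.Properties
  using (length-++; length-map; length-replicate; length-applyUpTo; map-++; map-cong; map-upTo; map-applyUpTo;
         concat-++; reverse-applyUpTo; ≡-dec)
open import Data.List.Membership.Propositional.Properties
open import Data.List.Membership.Propositional.Properties.WithK using (unique∧set⇒bag)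
open import Data.List.Relation.Binary.BagAndSetEquality using (∼bag⇒↭)
open import Data.List.Relation.Binary.Permutation.Propositional as ↭ using (_↭_)
open import Data.List.Relation.Binary.Permutation.Propositional.Properties using (↭-length) renaming (map⁺ to ↭-map⁺)
open import Data.List.Relation.Unary.All as All using ([]; _∷_)
open import Data.List.Relation.Unary.AllPairs using (AllPairs; []; _∷_)
import Data.List.Relation.Unary.AllPairs.Properties as AllPairsₚ
open import Data.List.Relation.Unary.Any using (here; there; tail; index)
open import Data.List.Relation.Unary.Any.Properties using (lookup-index)
import Data.List.Relation.Unary.Unique.Propositional.Properties as Uniqueₚ
open import Data.Vec as Vec using ([]; _∷_; toList; lookup; tabulate)
open import Data.Vec.Properties
  using (length-toList; lookup∘tabulate; tabulate∘lookup; tabulate-cong; []=⇒lookup; lookup⇒[]=)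
open import Data.Product using (∃-syntax; _,_; proj₁; proj₂)
open import Data.Sum as Sum using (_⊎_; inj₁; inj₂)
open import Data.Empty using (⊥-elim)
open import Data.Unit using (⊤; tt)
open import Function using (_∘_; mk⇔)
open import Relation.Binary using (tri<; tri≈; tri>)
open import Relation.Binary.Construct.Closure.ReflexiveTransitive as Star using (Star; ε; _◅_; _◅◅_; gmap)
open import Relation.Nullary using (¬_; yes; no)
open import Relation.Binary.PropositionalEquality hiding (J)

-- Sites of the ring ℤ/(k+1) and windows of consecutive integers.

module Sites (k : ℕ) where

  private
    n : ℕ
    n = suc k

  opaque
    ι : ℤ → Fin n
    ι = intMod n

    ι≡intMod : ∀ z → ι z ≡ intMod n z
    ι≡intMod z = refl

    toℕ-ι : ∀ z → toℕ (ι z) ≡ z %ℕ n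
    toℕ-ι z = Finₚ.toℕ-fromℕ< (n%ℕd<d z n)

  -- The numbers differ by the multiple `v - u` of `n`. If that multiple were nonzero, the larger of
  -- them would be at least `n`.
  residue-unique : ∀ {a b} u v → a < n → b < n →
                   + a ℤ.+ u ℤ.* + n ≡ + b ℤ.+ v ℤ.* + n → a ≡ b
  residue-unique {a} {b} u v a<n b<n eq = go (v ℤ.- u) a≡b+d
    where
    a≡b+d : + a ≡ + b ℤ.+ (v ℤ.- u) ℤ.* + n
    a≡b+d = trans (trans (move (+ a) u (+ n)) (cong (ℤ._- u ℤ.* + n) eq)) (collect (+ b) u v (+ n))
      where
      move : ∀ x u m → x ≡ (x ℤ.+ u ℤ.* m) ℤ.- u ℤ.* m
      move = solve-∀
      collect : ∀ y u v m → (y ℤ.+ v ℤ.* m) ℤ.- u ℤ.* m ≡ y ℤ.+ (v ℤ.- u) ℤ.* m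
      collect = solve-∀
    too-big : ∀ {x y} d → x < n → x ≡ y ℕ.+ suc d ℕ.* n → ∀ {A : Set} → A
    too-big {x} {y} d x<n refl =
      ⊥-elim (ℕₚ.<⇒≱ x<n (ℕₚ.≤-trans (ℕₚ.m≤m+n n (d ℕ.* n)) (ℕₚ.m≤n+m _ y)))
    go : ∀ d → + a ≡ + b ℤ.+ d ℤ.* + n → a ≡ b
    go (+ zero)  e = ℤₚ.+-injective (trans e (ℤₚ.+-identityʳ (+ b)))
    go (+ suc d) e = too-big d a<n (ℤₚ.+-injective (trans e (cong (ℤ._+_ (+ b)) (sym (ℤₚ.pos-* (suc d) n)))))
    go -[1+ d ]  e = too-big d b<n (ℤₚ.+-injective
      (trans (swap (+ b) (+ suc d) (+ n))
        (trans (cong (ℤ._+ + suc d ℤ.* + n) (sym e)) (cong (ℤ._+_ (+ a)) (sym (ℤₚ.pos-* (suc d) n))))))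
      where
      swap : ∀ y e m → y ≡ (y ℤ.+ (ℤ.- e) ℤ.* m) ℤ.+ e ℤ.* m
      swap = solve-∀

  decompose : ∀ z → z ≡ + toℕ (ι z) ℤ.+ (z /ℕ n) ℤ.* + n
  decompose z = trans (a≡a%ℕn+[a/ℕn]*n z n) (cong (λ t → + t ℤ.+ (z /ℕ n) ℤ.* + n) (sym (toℕ-ι z)))

  ι-unique : ∀ {m z} u → z ≡ + toℕ m ℤ.+ u ℤ.* + n → ι z ≡ m
  ι-unique {m} {z} u e = Finₚ.toℕ-injective
    (residue-unique (z /ℕ n) u (Finₚ.toℕ<n (ι z)) (Finₚ.toℕ<n m) (trans (sym (decompose z)) e))

  ι-toℕ : ∀ m → ι (+ toℕ m) ≡ m
  ι-toℕ m = ι-unique 0ℤ (sym (ℤₚ.+-identityʳ (+ toℕ m)))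

  ι-origin : ∀ m → ι (+ toℕ m ℤ.+ + 0) ≡ m
  ι-origin m = trans (cong ι (ℤₚ.+-identityʳ (+ toℕ m))) (ι-toℕ m)

  ι-periodic : ∀ z → ι (z ℤ.+ + n) ≡ ι z
  ι-periodic z = ι-unique (z /ℕ n ℤ.+ 1ℤ)
    (trans (cong (ℤ._+ + n) (decompose z)) (collect (+ toℕ (ι z)) (z /ℕ n) (+ n)))
    where
    collect : ∀ x q m → (x ℤ.+ q ℤ.* m) ℤ.+ m ≡ x ℤ.+ (q ℤ.+ 1ℤ) ℤ.* m
    collect = solve-∀

  ι-+ : ∀ z w → ι (+ toℕ (ι z) ℤ.+ w) ≡ ι (z ℤ.+ w)
  ι-+ z w = sym (ι-unique (z /ℕ n ℤ.+ (w′ /ℕ n))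
    (trans (cong (ℤ._+ w) (decompose z))
      (trans (regroup (+ toℕ (ι z)) (z /ℕ n) (+ n) w)
        (trans (cong (ℤ._+ z /ℕ n ℤ.* + n) (decompose w′)) (collect (+ toℕ (ι w′)) (z /ℕ n) (w′ /ℕ n) (+ n))))))
    where
    w′ = + toℕ (ι z) ℤ.+ w
    regroup : ∀ x q m w → x ℤ.+ q ℤ.* m ℤ.+ w ≡ (x ℤ.+ w) ℤ.+ q ℤ.* m
    regroup = solve-∀
    collect : ∀ x q q′ m → (x ℤ.+ q′ ℤ.* m) ℤ.+ q ℤ.* m ≡ x ℤ.+ (q ℤ.+ q′) ℤ.* m
    collect = solve-∀

  -- Inside a window of `n` consecutive integers starting at `B`, sites can be compared as natural
  -- numbers. All later collision arguments on the ring reduce to inequalities in ℕ through this.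
  ι-injective : ∀ B {p q} → p < n → q < n → ι (B ℤ.+ + p) ≡ ι (B ℤ.+ + q) → p ≡ q
  ι-injective B {p} {q} p<n q<n e =
    residue-unique (ℤ.- ((B ℤ.+ + p) /ℕ n)) (ℤ.- ((B ℤ.+ + q) /ℕ n)) p<n q<n
      (∙-cancelˡ B _ _
        (trans (isolate B (+ p) ((B ℤ.+ + p) /ℕ n) (+ n) _ (decompose (B ℤ.+ + p)))
          (trans (cong (λ m → + toℕ m) e) (sym (isolate B (+ q) ((B ℤ.+ + q) /ℕ n) (+ n) _ (decompose (B ℤ.+ + q)))))))
    where
    regroup : ∀ B p u m → B ℤ.+ (p ℤ.+ (ℤ.- u) ℤ.* m) ≡ (B ℤ.+ p) ℤ.- u ℤ.* m
    regroup = solve-∀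
    cancel : ∀ x y → (x ℤ.+ y) ℤ.- y ≡ x
    cancel = solve-∀
    isolate : ∀ B p u m x → B ℤ.+ p ≡ x ℤ.+ u ℤ.* m → B ℤ.+ (p ℤ.+ (ℤ.- u) ℤ.* m) ≡ x
    isolate B p u m x e = trans (regroup B p u m) (trans (cong (ℤ._- u ℤ.* m) e) (cancel x (u ℤ.* m)))

  ι-surjective : ∀ B m → ∃[ p ] (p < n × m ≡ ι (B ℤ.+ + p))
  ι-surjective B m = toℕ (ι d) , Finₚ.toℕ<n (ι d) ,
    sym (trans (cong ι (ℤₚ.+-comm B _)) (trans (ι-+ d B) (trans (cong ι (cancel (+ toℕ m) B)) (ι-toℕ m))))
    where
    d = + toℕ m ℤ.- B
    cancel : ∀ x y → (x ℤ.- y) ℤ.+ y ≡ x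
    cancel = solve-∀

  nx : Fin n → Fin n
  nx m = ι (+ toℕ m ℤ.+ 1ℤ)

  nx≡next : ∀ m → nx m ≡ next n m
  nx≡next m = ι≡intMod (+ toℕ m ℤ.+ 1ℤ)

  nx-ι : ∀ z → nx (ι z) ≡ ι (z ℤ.+ 1ℤ)
  nx-ι z = ι-+ z 1ℤ

  ι-suc : ∀ B p → ι (B ℤ.+ + suc p) ≡ nx (ι (B ℤ.+ + p))
  ι-suc B p = sym (trans (nx-ι (B ℤ.+ + p)) (cong ι (assoc B (+ p))))
    where
    assoc : ∀ B p → (B ℤ.+ p) ℤ.+ 1ℤ ≡ B ℤ.+ (1ℤ ℤ.+ p)
    assoc = solve-∀

  pv : Fin n → Fin n
  pv m = ι (+ toℕ m ℤ.- 1ℤ)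

  pv-nx : ∀ m → pv (nx m) ≡ m
  pv-nx m = trans (ι-+ (+ toℕ m ℤ.+ 1ℤ) (ℤ.- 1ℤ)) (trans (cong ι (cancel (+ toℕ m))) (ι-toℕ m))
    where
    cancel : ∀ x → (x ℤ.+ 1ℤ) ℤ.- 1ℤ ≡ x
    cancel = solve-∀

  nx-pv : ∀ m → nx (pv m) ≡ m
  nx-pv m = trans (ι-+ (+ toℕ m ℤ.- 1ℤ) 1ℤ) (trans (cong ι (cancel (+ toℕ m))) (ι-toℕ m))
    where
    cancel : ∀ x → (x ℤ.- 1ℤ) ℤ.+ 1ℤ ≡ x
    cancel = solve-∀

  nx-injective : ∀ {a b} → nx a ≡ nx b → a ≡ b
  nx-injective {a} {b} e = trans (sym (pv-nx a)) (trans (cong pv e) (pv-nx b))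

  nx≢ : 1 ≤ k → ∀ a → nx a ≢ a
  nx≢ 1≤k a e = ℕₚ.1+n≢0 {0} (ι-injective (+ toℕ a) (s≤s 1≤k) (s≤s z≤n) (trans e (sym (ι-origin a))))

  nx²≢ : 2 ≤ k → ∀ a → nx (nx a) ≢ a
  nx²≢ 2≤k a e = ℕₚ.1+n≢0 {1} (ι-injective (+ toℕ a) (s≤s 2≤k) (s≤s z≤n)
    (trans (trans (ι-suc (+ toℕ a) 1) e) (sym (ι-origin a))))

  -- The ring is a single cycle, so iterating `nx` from any starting site reaches every site.
  nx-induction : ∀ {p} (P : Fin n → Set p) → (∀ m → P m → P (nx m)) → ∀ a → P a → ∀ m → P m
  nx-induction P step a Pa m = subst P (sym (proj₂ (proj₂ found))) (go (proj₁ found))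
    where
    found : ∃[ t ] (t < n × m ≡ ι (+ toℕ a ℤ.+ + t))
    found = ι-surjective (+ toℕ a) m
    go : ∀ t → P (ι (+ toℕ a ℤ.+ + t))
    go zero    = subst P (sym (ι-origin a)) Pa
    go (suc t) = subst P (sym (ι-suc (+ toℕ a) t)) (step (ι (+ toℕ a ℤ.+ + t)) (go t))

-- The particle process on the ring and the invariance of its flux under the relations of W.

module Exclusion (k : ℕ) (1≤k : 1 ≤ k) where

  open Sites k

  Site : Set
  Site = Fin (suc k)

  Word : Set
  Word = List Site

  State : Set
  State = Site → Bool

  opaque
    τ : Site → Site → Site
    τ i m with m ≟ i | m ≟ nx i
    ... | yes _ | _     = nx i
    ... | no _  | yes _ = i
    ... | no _  | no _  = m

    τ-left : ∀ i → τ i i ≡ nx i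
    τ-left i with i ≟ i
    ... | yes _ = refl
    ... | no p  = ⊥-elim (p refl)

    τ-right : ∀ i → τ i (nx i) ≡ i
    τ-right i with nx i ≟ i | nx i ≟ nx i
    ... | yes e | _     = e
    ... | no _  | yes _ = refl
    ... | no _  | no p  = ⊥-elim (p refl)

    τ-fix : ∀ i {m} → m ≢ i → m ≢ nx i → τ i m ≡ m
    τ-fix i {m} p q with m ≟ i | m ≟ nx i
    ... | yes e | _     = ⊥-elim (p e)
    ... | no _  | yes e = ⊥-elim (q e)
    ... | no _  | no _  = refl

  τ-involutive : ∀ i m → τ i (τ i m) ≡ m
  τ-involutive i m with m ≟ i | m ≟ nx i
  ... | yes refl | _ = trans (cong (τ i) (τ-left i)) (τ-right i)
  ... | no _ | yes refl = trans (cong (τ i) (τ-right i)) (τ-left i)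
  ... | no p | no q = trans (cong (τ i) (τ-fix i p q)) (τ-fix i p q)

  -- The bonds from `i` to `nx i` and from `j` to `nx j` share no site.
  Distant : Site → Site → Set
  Distant i j = i ≢ j × j ≢ nx i × i ≢ nx j

  τ-commute : ∀ {i j} → Distant i j → ∀ m → τ i (τ j m) ≡ τ j (τ i m)
  τ-commute {i} {j} (i≢j , j≢i⁺ , i≢j⁺) m with m ≟ i | m ≟ nx i | m ≟ j | m ≟ nx j
  ... | yes refl | _ | _ | _ =
    trans (cong (τ i) (τ-fix j i≢j i≢j⁺))
      (trans (τ-left i) (sym (trans (cong (τ j) (τ-left i)) (τ-fix j (j≢i⁺ ∘ sym) (i≢j ∘ nx-injective)))))
  ... | no _ | yes refl | _ | _ =
    trans (cong (τ i) (τ-fix j (j≢i⁺ ∘ sym) (i≢j ∘ nx-injective)))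
      (trans (τ-right i) (sym (trans (cong (τ j) (τ-right i)) (τ-fix j i≢j i≢j⁺))))
  ... | no _ | no _ | yes refl | _ =
    trans (cong (τ i) (τ-left j))
      (trans (τ-fix i (i≢j⁺ ∘ sym) (i≢j ∘ sym ∘ nx-injective))
        (sym (trans (cong (τ j) (τ-fix i (i≢j ∘ sym) j≢i⁺)) (τ-left j))))
  ... | no _ | no _ | no _ | yes refl =
    trans (cong (τ i) (τ-right j))
      (trans (τ-fix i (i≢j ∘ sym) j≢i⁺)
        (sym (trans (cong (τ j) (τ-fix i (i≢j⁺ ∘ sym) (i≢j ∘ sym ∘ nx-injective))) (τ-right j))))
  ... | no a | no b | no c | no d =
    trans (cong (τ i) (τ-fix j c d))
      (trans (τ-fix i a b) (sym (trans (cong (τ j) (τ-fix i a b)) (τ-fix j c d))))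

  act : State → Word → State
  act S []      = S
  act S (i ∷ w) = act (S ∘ τ i) w

  act-cong : ∀ {S S′} → S ≗ S′ → ∀ w → act S w ≗ act S′ w
  act-cong e []      = e
  act-cong e (i ∷ w) = act-cong (e ∘ τ i) w

  act-++ : ∀ S u v → act S (u ++ v) ≗ act (act S u) v
  act-++ S []      v m = refl
  act-++ S (i ∷ u) v   = act-++ (S ∘ τ i) u v

  occ : Bool → ℕ
  occ true  = 1
  occ false = 0

  -- The signed number of particles that cross each bond, weighted by f.
  Φ : (Site → ℕ) → State → Word → ℤ
  Φ f S []      = 0ℤ
  Φ f S (i ∷ w) = + f i ℤ.* (+ occ (S i) ℤ.- + occ (S (nx i))) ℤ.+ Φ f (S ∘ τ i) w

  Φ-cong : ∀ f {S S′} → S ≗ S′ → ∀ w → Φ f S w ≡ Φ f S′ w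
  Φ-cong f e []      = refl
  Φ-cong f e (i ∷ w) =
    cong₂ ℤ._+_ (cong (ℤ._*_ (+ f i)) (cong₂ ℤ._-_ (cong (λ b → + occ b) (e i)) (cong (λ b → + occ b) (e (nx i)))))
                (Φ-cong f (e ∘ τ i) w)

  Φ-++ : ∀ f S u v → Φ f S (u ++ v) ≡ Φ f S u ℤ.+ Φ f (act S u) v
  Φ-++ f S []      v = sym (ℤₚ.+-identityˡ _)
  Φ-++ f S (i ∷ u) v =
    trans (cong (ℤ._+_ hop) (Φ-++ f (S ∘ τ i) u v))
      (sym (ℤₚ.+-assoc hop (Φ f (S ∘ τ i) u) (Φ f (act (S ∘ τ i) u) v)))
    where
    hop = + f i ℤ.* (+ occ (S i) ℤ.- + occ (S (nx i)))

  -- Quantifying over all states makes the notion stable under contexts: after a prefix the state is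
  -- arbitrary, and before a suffix equal final states are needed.
  Agree : Word → Word → Set
  Agree a b = ∀ S → act S a ≗ act S b × (∀ f → Φ f S a ≡ Φ f S b)

  distant : ∀ {i j} → i ≢ j → ¬ Adjacent (suc k) i j → Distant i j
  distant {i} {j} i≢j ¬adj =
    i≢j , (λ e → ¬adj (inj₁ (trans e (nx≡next i)))) , (λ e → ¬adj (inj₂ (trans e (nx≡next j))))

  -- The second exchange carries back whatever the first one carried, so the two contributions
  -- cancel.
  square-agree : ∀ i → Agree (i ∷ i ∷ []) []
  square-agree i S = (λ m → cong S (τ-involutive i m)) , λ f →
    trans (cong₂ (λ x y → + f i ℤ.* (+ occ (S i) ℤ.- + occ (S (nx i))) ℤ.+
                          (+ f i ℤ.* (+ occ (S x) ℤ.- + occ (S y)) ℤ.+ 0ℤ))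
                 (τ-left i) (τ-right i))
          (cancel (+ f i) (+ occ (S i)) (+ occ (S (nx i))))
    where
    cancel : ∀ f a b → f ℤ.* (a ℤ.- b) ℤ.+ (f ℤ.* (b ℤ.- a) ℤ.+ 0ℤ) ≡ 0ℤ
    cancel = solve-∀

  commutation-agree : ∀ {i j} → ¬ Adjacent (suc k) i j → Agree (i ∷ j ∷ []) (j ∷ i ∷ [])
  commutation-agree {i} {j} ¬adj S with i ≟ j
  -- `w-comm` also allows `i` = `j`, since no site is its own neighbour; the two words then
  -- coincide.
  ... | yes refl = (λ m → refl) , (λ f → refl)
  ... | no i≢j = (λ m → cong S (τ-commute far m)) , λ f →
      trans (cong₂ (λ x y → hop f i (S i) (S (nx i)) ℤ.+ (hop f j (S x) (S y) ℤ.+ 0ℤ))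
                   (τ-fix i (i≢j ∘ sym) j≢i⁺) (τ-fix i (i≢j⁺ ∘ sym) (i≢j ∘ sym ∘ nx-injective)))
        (trans (exchange (hop f i (S i) (S (nx i))) (hop f j (S j) (S (nx j))))
          (sym (cong₂ (λ x y → hop f j (S j) (S (nx j)) ℤ.+ (hop f i (S x) (S y) ℤ.+ 0ℤ))
                      (τ-fix j i≢j i≢j⁺) (τ-fix j (j≢i⁺ ∘ sym) (i≢j ∘ nx-injective)))))
    where
    far : Distant i j
    far = distant i≢j ¬adj
    j≢i⁺ = proj₁ (proj₂ far)
    i≢j⁺ = proj₂ (proj₂ far)
    hop : (Site → ℕ) → Site → Bool → Bool → ℤ
    hop f i a b = + f i ℤ.* (+ occ a ℤ.- + occ b)
    exchange : ∀ x y → x ℤ.+ (y ℤ.+ 0ℤ) ≡ y ℤ.+ (x ℤ.+ 0ℤ)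
    exchange = solve-∀

  -- Both words reverse the contents `a`, `b`, `c` of three consecutive sites, and both have flux
  -- `(f i + f j)(a - c)`. The bound `2 ≤ k` makes the three sites distinct.
  braid-agree : 2 ≤ k → ∀ i j → j ≡ nx i → Agree (i ∷ j ∷ i ∷ []) (j ∷ i ∷ j ∷ [])
  braid-agree 2≤k i .(nx i) refl S = (λ m → cong S (braid m)) , λ f →
      trans (cong (ℤ._+_ (hop f i (S i) (S j)))
              (cong₂ ℤ._+_ (cong₂ (λ x y → hop f j (S x) (S y)) ij il)
                (cong (ℤ._+ 0ℤ) (cong₂ (λ x y → hop f i (S x) (S y))
                  (trans (cong (τ i) ji) ii) (trans (cong (τ i) jj) il)))))
        (trans (rearrange (+ f i) (+ f j) (+ occ (S i)) (+ occ (S j)) (+ occ (S l)))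
          (sym (cong (ℤ._+_ (hop f j (S j) (S l)))
              (cong₂ ℤ._+_ (cong₂ (λ x y → hop f i (S x) (S y)) ji jj)
                (cong (ℤ._+ 0ℤ) (cong₂ (λ x y → hop f j (S x) (S y))
                  (trans (cong (τ j) ij) ji) (trans (cong (τ j) il) jl)))))))
    where
    j = nx i
    l = nx j
    hop : (Site → ℕ) → Site → Bool → Bool → ℤ
    hop f i a b = + f i ℤ.* (+ occ a ℤ.- + occ b)
    ii : τ i i ≡ j
    ii = τ-left i
    ij : τ i j ≡ i
    ij = τ-right i
    il : τ i l ≡ l
    il = τ-fix i (nx²≢ 2≤k i) (nx≢ 1≤k j)
    ji : τ j i ≡ i
    ji = τ-fix j (nx≢ 1≤k i ∘ sym) (nx²≢ 2≤k i ∘ sym)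
    jj : τ j j ≡ l
    jj = τ-left j
    jl : τ j l ≡ j
    jl = τ-right j
    rearrange : ∀ f g a b c →
      f ℤ.* (a ℤ.- b) ℤ.+ (g ℤ.* (a ℤ.- c) ℤ.+ (f ℤ.* (b ℤ.- c) ℤ.+ 0ℤ)) ≡
      g ℤ.* (b ℤ.- c) ℤ.+ (f ℤ.* (a ℤ.- c) ℤ.+ (g ℤ.* (a ℤ.- b) ℤ.+ 0ℤ))
    rearrange = solve-∀
    chain : ∀ {a b c d x y z} → τ x a ≡ b → τ y b ≡ c → τ z c ≡ d → τ z (τ y (τ x a)) ≡ d
    chain {y = y} {z} p q r = trans (cong (τ z) (trans (cong (τ y) p) q)) r
    braid : ∀ m → τ i (τ j (τ i m)) ≡ τ j (τ i (τ j m))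
    braid m with m ≟ i | m ≟ j | m ≟ l
    ... | yes refl | _ | _ = trans (chain ii jj il) (sym (chain ji ii jj))
    ... | no _ | yes refl | _ = trans (chain ij ji ii) (sym (chain jj il jl))
    ... | no _ | no _ | yes refl = trans (chain il jl ij) (sym (chain jl ij ji))
    ... | no a | no b | no c =
      trans (chain (τ-fix i a b) (τ-fix j b c) (τ-fix i a b))
        (sym (chain (τ-fix j b c) (τ-fix i a b) (τ-fix j b c)))

  step-agree : ∀ {a b} → WStep k a b → Agree a b
  step-agree (w-sq i)         = square-agree i
  step-agree (w-comm i j ¬a)  = commutation-agree ¬a
  step-agree (w-braid 2≤k i)  = braid-agree 2≤k i (next (suc k) i) (sym (nx≡next i))

  context-agree : ∀ p q {a b} → Agree a b → Agree (p ++ a ++ q) (p ++ b ++ q)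
  context-agree p q {a} {b} agr S = same-act , same-Φ
    where
    P = act S p
    same-act : act S (p ++ a ++ q) ≗ act S (p ++ b ++ q)
    same-act m = begin
      act S (p ++ a ++ q) m   ≡⟨ act-++ S p (a ++ q) m ⟩
      act P (a ++ q) m        ≡⟨ act-++ P a q m ⟩
      act (act P a) q m       ≡⟨ act-cong (proj₁ (agr P)) q m ⟩
      act (act P b) q m       ≡⟨ act-++ P b q m ⟨
      act P (b ++ q) m        ≡⟨ act-++ S p (b ++ q) m ⟨
      act S (p ++ b ++ q) m   ∎
      where open ≡-Reasoning
    same-Φ : ∀ f → Φ f S (p ++ a ++ q) ≡ Φ f S (p ++ b ++ q)
    same-Φ f = begin
      Φ f S (p ++ a ++ q)                             ≡⟨ Φ-++ f S p (a ++ q) ⟩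
      Φ f S p ℤ.+ Φ f P (a ++ q)                      ≡⟨ cong (ℤ._+_ (Φ f S p)) (Φ-++ f P a q) ⟩
      Φ f S p ℤ.+ (Φ f P a ℤ.+ Φ f (act P a) q)       ≡⟨ cong (ℤ._+_ (Φ f S p))
          (cong₂ ℤ._+_ (proj₂ (agr P) f) (Φ-cong f (proj₁ (agr P)) q)) ⟩
      Φ f S p ℤ.+ (Φ f P b ℤ.+ Φ f (act P b) q)       ≡⟨ cong (ℤ._+_ (Φ f S p)) (Φ-++ f P b q) ⟨
      Φ f S p ℤ.+ Φ f P (b ++ q)                      ≡⟨ Φ-++ f S p (b ++ q) ⟨
      Φ f S (p ++ b ++ q)                             ∎
      where open ≡-Reasoning

  ∼W⇒agree : ∀ {x y} → x ∼W y → Agree x y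
  ∼W⇒agree ∼refl S = (λ m → refl) , (λ f → refl)
  ∼W⇒agree (∼sym e) S = (λ m → sym (proj₁ (∼W⇒agree e S) m)) , (λ f → sym (proj₂ (∼W⇒agree e S) f))
  ∼W⇒agree (∼trans e e′) S =
    (λ m → trans (proj₁ (∼W⇒agree e S) m) (proj₁ (∼W⇒agree e′ S) m)) ,
    (λ f → trans (proj₂ (∼W⇒agree e S) f) (proj₂ (∼W⇒agree e′ S) f))
  ∼W⇒agree (∼step p q s) = context-agree p q (step-agree s)

  -- Legal words and the bound of the total flux by the length.

  Legal : State → Word → Set
  Legal S []      = ⊤
  Legal S (i ∷ w) = (S i ≡ true × S (nx i) ≡ false) × Legal (S ∘ τ i) w

  Legal-cong : ∀ {S S′} → S ≗ S′ → ∀ w → Legal S w → Legal S′ w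
  Legal-cong e []      _ = tt
  Legal-cong e (i ∷ w) ((p , q) , l) =
    (trans (sym (e i)) p , trans (sym (e (nx i))) q) , Legal-cong (e ∘ τ i) w l

  Legal-++ : ∀ S u v → Legal S u → Legal (act S u) v → Legal S (u ++ v)
  Legal-++ S []      v _        l = l
  Legal-++ S (i ∷ u) v (h , l′) l = h , Legal-++ (S ∘ τ i) u v l′ l

  weight : (Site → ℕ) → Word → ℕ
  weight f []      = 0
  weight f (i ∷ w) = f i + weight f w

  -- A legal letter carries exactly one particle forward, so it contributes its full weight.
  Φ-legal : ∀ f S w → Legal S w → Φ f S w ≡ + weight f w
  Φ-legal f S []      _ = refl
  Φ-legal f S (i ∷ w) ((p , q) , l) = cong₂ ℤ._+_
    (trans (cong₂ (λ a b → + f i ℤ.* (+ occ a ℤ.- + occ b)) p q) (ℤₚ.*-identityʳ (+ f i)))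
    (Φ-legal f (S ∘ τ i) w l)

  hop≤1 : ∀ a b → + 1 ℤ.* (+ occ a ℤ.- + occ b) ℤ.≤ + 1
  hop≤1 true  true  = ℤ.+≤+ z≤n
  hop≤1 true  false = ℤ.+≤+ (s≤s z≤n)
  hop≤1 false true  = ℤ.-≤+
  hop≤1 false false = ℤ.+≤+ z≤n

  Φ≤length : ∀ S w → Φ (λ _ → 1) S w ℤ.≤ + length w
  Φ≤length S []      = ℤₚ.≤-refl
  Φ≤length S (i ∷ w) = ℤₚ.+-mono-≤ (hop≤1 (S i) (S (nx i))) (Φ≤length (S ∘ τ i) w)

  -- A letter contributes at most 1, and it contributes 1 only when it moves a particle into an
  -- empty site. A single letter contributing less would already push the total below the length.
  legal-of-Φ : ∀ S w → + length w ℤ.≤ Φ (λ _ → 1) S w → Legal S w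
  legal-of-Φ S []      _ = tt
  legal-of-Φ S (i ∷ w) le = split (S i) (S (nx i)) refl refl le
    where
    Φ′ = Φ (λ _ → 1) (S ∘ τ i) w
    loss : ∀ {x} → x ℤ.≤ 0ℤ → ¬ (+ suc (length w) ℤ.≤ x ℤ.+ Φ′)
    loss x≤0 le with ℤₚ.≤-trans le (ℤₚ.+-mono-≤ x≤0 (Φ≤length (S ∘ τ i) w))
    ... | ℤ.+≤+ le′ = ℕₚ.1+n≰n le′
    cancel : ∀ {x y} → + 1 ℤ.+ x ℤ.≤ + 1 ℤ.+ y → x ℤ.≤ y
    cancel {x} {y} h = subst₂ ℤ._≤_ (drop x) (drop y) (ℤₚ.+-monoʳ-≤ -1ℤ h)
      where
      drop : ∀ x → -1ℤ ℤ.+ (+ 1 ℤ.+ x) ≡ x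
      drop = solve-∀
    split : ∀ a b → S i ≡ a → S (nx i) ≡ b →
            + suc (length w) ℤ.≤ + 1 ℤ.* (+ occ a ℤ.- + occ b) ℤ.+ Φ′ → Legal S (i ∷ w)
    split true  true  _ _ le = ⊥-elim (loss (ℤ.+≤+ z≤n) le)
    split false true  _ _ le = ⊥-elim (loss ℤ.-≤+ le)
    split false false _ _ le = ⊥-elim (loss (ℤ.+≤+ z≤n) le)
    split true  false p q le = (p , q) , legal-of-Φ (S ∘ τ i) w (cancel le)

  weight-one : ∀ w → weight (λ _ → 1) w ≡ length w
  weight-one []      = refl
  weight-one (i ∷ w) = cong suc (weight-one w)

  -- The words have the same total flux, which for the legal `y` is its length. Hence the flux of
  -- `x` is at least the length of `x`.
  short⇒legal : ∀ {S x y} → x ∼W y → length x ≤ length y → Legal S y → Legal S x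
  short⇒legal {S} {x} {y} e le l = legal-of-Φ S x
    (subst (+ length x ℤ.≤_)
      (sym (trans (proj₂ (∼W⇒agree e S) (λ _ → 1)) (trans (Φ-legal _ S y l) (cong +_ (weight-one y)))))
      (ℤ.+≤+ le))

  -- Letter counts and commutation classes of legal words.

  ind : Site → Site → ℕ
  ind m i with m ≟ i
  ... | yes _ = 1
  ... | no _  = 0

  ind-refl : ∀ m → ind m m ≡ 1
  ind-refl m with m ≟ m
  ... | yes _ = refl
  ... | no p  = ⊥-elim (p refl)

  ind≤1 : ∀ m i → ind m i ≤ 1
  ind≤1 m i with m ≟ i
  ... | yes _ = s≤s z≤n
  ... | no _  = z≤n

  count : Site → Word → ℕ
  count m = weight (ind m)

  -- On legal words the flux weighted by the indicator of `m` counts the letter `m`, and every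
  -- weighted flux is invariant.
  ∼W-legal-count : ∀ {S x y} → x ∼W y → Legal S x → Legal S y → ∀ m → count m x ≡ count m y
  ∼W-legal-count {S} {x} {y} e lx ly m = ℤₚ.+-injective
    (trans (sym (Φ-legal (ind m) S x lx)) (trans (proj₂ (∼W⇒agree e S) (ind m)) (Φ-legal (ind m) S y ly)))

  count⇒∈ : ∀ m w → 1 ≤ count m w → m ∈ w
  count⇒∈ m (i ∷ w) le with m ≟ i
  ... | yes e = here e
  ... | no _  = there (count⇒∈ m w le)

  count-head : ∀ i w → 1 ≤ count i (i ∷ w)
  count-head i w = subst (λ t → 1 ≤ t + count i w) (sym (ind-refl i)) (s≤s z≤n)

  data Commute : Word → Word → Set where
    swap-at : ∀ p q {i j} → ¬ Adjacent (suc k) i j → Commute (p ++ i ∷ j ∷ q) (p ++ j ∷ i ∷ q)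

  _≈c_ : Word → Word → Set
  _≈c_ = Star Commute

  ≈c-∷ : ∀ a {x y} → x ≈c y → (a ∷ x) ≈c (a ∷ y)
  ≈c-∷ a = gmap (a ∷_) λ { (swap-at p q ¬a) → swap-at (a ∷ p) q ¬a }

  true≢false : ∀ {b} → b ≡ true → b ≢ false
  true≢false refl ()

  -- Two distinct hops that are possible in the same state never touch, so a hop that is possible
  -- now stays possible until it is made, and it commutes with everything made before it.
  bring-to-front : ∀ {S} i y → S i ≡ true → S (nx i) ≡ false → Legal S y → i ∈ y →
    ∃[ y′ ] (y ≈c (i ∷ y′) × Legal (S ∘ τ i) y′ × (∀ m → count m y ≡ count m (i ∷ y′)))
  bring-to-front {S} i (j ∷ y) full empty ((fullⱼ , emptyⱼ) , l) i∈ with i ≟ j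
  ... | yes refl = y , ε , l , λ m → refl
  ... | no i≢j = extend (bring-to-front i y full′ empty′ l (tail i≢j i∈))
    where
    j≢i⁺ : j ≢ nx i
    j≢i⁺ e = true≢false fullⱼ (trans (cong S e) empty)
    i≢j⁺ : i ≢ nx j
    i≢j⁺ e = true≢false full (trans (cong S e) emptyⱼ)
    full′ : S (τ j i) ≡ true
    full′ = trans (cong S (τ-fix j i≢j i≢j⁺)) full
    empty′ : S (τ j (nx i)) ≡ false
    empty′ = trans (cong S (τ-fix j (j≢i⁺ ∘ sym) (i≢j ∘ nx-injective))) empty
    ¬adj : ¬ Adjacent (suc k) j i
    ¬adj (inj₁ e) = i≢j⁺ (trans e (sym (nx≡next j)))
    ¬adj (inj₂ e) = j≢i⁺ (trans e (sym (nx≡next i)))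
    extend : ∃[ y′ ] (y ≈c (i ∷ y′) × Legal (S ∘ τ j ∘ τ i) y′ × (∀ m → count m y ≡ count m (i ∷ y′))) →
             ∃[ y′ ] ((j ∷ y) ≈c (i ∷ y′) × Legal (S ∘ τ i) y′ × (∀ m → count m (j ∷ y) ≡ count m (i ∷ y′)))
    extend (y′ , y≈ , l′ , counts) =
      j ∷ y′ ,
      (≈c-∷ j y≈ ◅◅ swap-at [] y′ ¬adj ◅ ε) ,
      ((trans (cong S (τ-fix i (i≢j ∘ sym) j≢i⁺)) fullⱼ ,
        trans (cong S (τ-fix i (i≢j⁺ ∘ sym) (i≢j ∘ sym ∘ nx-injective))) emptyⱼ) ,
       Legal-cong (λ m → cong S (sym (τ-commute (i≢j , j≢i⁺ , i≢j⁺) m))) y′ l′) ,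
      λ m → trans (cong (ℕ._+_ (ind m j)) (counts m)) (x∙yz≈y∙xz (ind m j) (ind m i) (count m y′))

  -- Induction on `x`: its first letter is possible in `S` and occurs in `y` by the counts, so it
  -- can be brought to the front of `y` and cancelled from both words.
  legal-count⇒≈c : ∀ {S} x y → Legal S x → Legal S y → (∀ m → count m x ≡ count m y) → x ≈c y
  legal-count⇒≈c []      []      _ _ _ = ε
  legal-count⇒≈c []      (j ∷ y) _ _ e with subst (1 ≤_) (sym (e j)) (count-head j y)
  ... | ()
  legal-count⇒≈c {S} (i ∷ x) y ((full , empty) , lx) ly e
    with bring-to-front {S} i y full empty ly (count⇒∈ i y (subst (1 ≤_) (e i) (count-head i x)))
  ... | y′ , y≈ , ly′ , counts =
    ≈c-∷ i (legal-count⇒≈c x y′ lx ly′ λ m → ℕₚ.+-cancelˡ-≡ (ind m i) _ _ (trans (e m) (counts m)))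
      ◅◅ reverse-≈c y≈
    where
    symm : ∀ {u v} → Commute u v → Commute v u
    symm (swap-at p q ¬a) = swap-at p q (¬a ∘ Sum.swap)
    reverse-≈c : ∀ {u v} → u ≈c v → v ≈c u
    reverse-≈c = Star.reverse symm

  count-++-∷ : ∀ m p i q → count m (p ++ i ∷ q) ≡ ind m i + count m (p ++ q)
  count-++-∷ m []      i q = refl
  count-++-∷ m (a ∷ p) i q = trans (cong (ℕ._+_ (ind m a)) (count-++-∷ m p i q)) (x∙yz≈y∙xz (ind m a) (ind m i) _)

  length-++-∷ : ∀ p (i : Site) q → length (p ++ i ∷ q) ≡ suc (length (p ++ q))
  length-++-∷ []      i q = refl
  length-++-∷ (a ∷ p) i q = cong suc (length-++-∷ p i q)

  count≤⇒length≤ : ∀ x y → (∀ m → count m x ≤ count m y) → length x ≤ length y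
  count≤⇒length≤ []      y le = z≤n
  count≤⇒length≤ (i ∷ x) y le with ∈-∃++ (count⇒∈ i y (ℕₚ.≤-trans (count-head i x) (le i)))
  ... | p , q , refl = subst (suc (length x) ≤_) (sym (length-++-∷ p i q))
    (s≤s (count≤⇒length≤ x (p ++ q) λ m →
      ℕₚ.+-cancelˡ-≤ (ind m i) _ _ (subst (ind m i + count m x ≤_) (count-++-∷ m p i q) (le m))))

  -- Deleting the first letter of `y` lowers each count by at most 1, so the strict inequalities
  -- become weak ones for a word that is one letter shorter.
  count<⇒length< : ∀ x y → (∀ m → count m x < count m y) → length x < length y
  count<⇒length< x []      lt with lt Fin.zero
  ... | ()
  count<⇒length< x (j ∷ y) lt = s≤s (count≤⇒length≤ x y λ m →
    ℕₚ.≤-pred (ℕₚ.≤-trans (lt m) (ℕₚ.+-monoˡ-≤ (count m y) (ind≤1 m j))))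

  -- Along a legal word each letter `m` brings a particle to the site `nx m`, and each letter `nx m`
  -- takes one away.
  conservation : ∀ S w → Legal S w → ∀ m →
    occ (act S w (nx m)) + count (nx m) w ≡ occ (S (nx m)) + count m w
  conservation S []      _ m = refl
  conservation S (i ∷ w) ((full , empty) , l) m =
    trans (x∙yz≈y∙xz (occ (act (S ∘ τ i) w (nx m))) (ind (nx m) i) (count (nx m) w))
      (trans (cong (ℕ._+_ (ind (nx m) i)) (conservation (S ∘ τ i) w l m))
        (trans (assoc (ind (nx m) i) (occ (S (τ i (nx m)))) (count m w))
          (trans (cong (ℕ._+ count m w) hop) (ℕₚ.+-assoc (occ (S (nx m))) (ind m i) (count m w)))))
    where
    assoc : ∀ a b c → a + (b + c) ≡ (b + a) + c
    assoc = ℕ-solve-∀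
    hop : occ (S (τ i (nx m))) + ind (nx m) i ≡ occ (S (nx m)) + ind m i
    hop with m ≟ i | nx m ≟ i
    ... | yes refl | yes e = ⊥-elim (nx≢ 1≤k m e)
    ... | yes refl | no _ rewrite τ-right m | full | empty = refl
    ... | no p | yes refl rewrite τ-left (nx m) | full | empty = refl
    ... | no p | no q = cong (λ s → occ (S s) + 0) (τ-fix i q (p ∘ nx-injective))

  -- By conservation the bond counts of two legal words between the same states differ by a constant.
  spread-< : ∀ {S x y} → Legal S x → Legal S y → act S x ≗ act S y → ∀ a →
             count a x < count a y → ∀ m → count m x < count m y
  spread-< {S} {x} {y} lx ly ends = nx-induction (λ m → count m x < count m y) λ m lt →
    ℕₚ.+-cancelˡ-< (occ (act S x (nx m))) _ _
      (subst₂ _<_ (sym (conservation S x lx m))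
        (trans (sym (conservation S y ly m)) (cong (λ b → occ b + count (nx m) y) (sym (ends (nx m)))))
        (ℕₚ.+-monoʳ-< (occ (S (nx m))) lt))

  -- If the counts differed at one letter, they would differ in the same direction at all letters,
  -- and then so would the lengths.
  same-ends⇒count : ∀ {S x y} → Legal S x → Legal S y → act S x ≗ act S y → length x ≡ length y →
                    ∀ m → count m x ≡ count m y
  same-ends⇒count {S} {x} {y} lx ly ends len m with ℕₚ.<-cmp (count m x) (count m y)
  ... | tri≈ _ e _ = e
  ... | tri< lt _ _ = ⊥-elim (ℕₚ.<-irrefl len
    (count<⇒length< x y (spread-< {S} {x} {y} lx ly ends m lt)))
  ... | tri> _ _ gt = ⊥-elim (ℕₚ.<-irrefl (sym len)
    (count<⇒length< y x (spread-< {S} {y} {x} ly lx (sym ∘ ends) m gt)))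

  -- A word of minimal length must spend every letter on a hop, because the total flux is an invariant of W.
  reduced≈c : ∀ {S x v u} → IsReducedWordOf x v → Legal S v → Legal S u →
              act S v ≗ act S u → length v ≡ length u → x ≈c u
  reduced≈c {S} {x} {v} {u} (x∼v , minimal) lv lu ends len =
    legal-count⇒≈c x u lx lu λ m → trans (∼W-legal-count x∼v lx lv m) (same-ends⇒count {S} {v} {u} lv lu ends len m)
    where
    lx : Legal S x
    lx = short⇒legal {S} {x} {v} x∼v (minimal v ∼refl) lv

-- Duplicate-free lists and cardinalities of subsets.

private
  variable
    X : Set
    n : ℕ

unique-↭ : {xs ys : List X} → Unique xs → Unique ys →
           (∀ {x} → x ∈ xs → x ∈ ys) → (∀ {x} → x ∈ ys → x ∈ xs) → xs ↭ ys
unique-↭ p q f g = ∼bag⇒↭ (unique∧set⇒bag p q (mk⇔ f g))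

elements : Subset n → List (Fin n)
elements []          = []
elements (true  ∷ D) = Fin.zero ∷ map Fin.suc (elements D)
elements (false ∷ D) = map Fin.suc (elements D)

length-elements : (D : Subset n) → length (elements D) ≡ ∣ D ∣
length-elements []          = refl
length-elements (true  ∷ D) = cong suc (trans (length-map Fin.suc (elements D)) (length-elements D))
length-elements (false ∷ D) = trans (length-map Fin.suc (elements D)) (length-elements D)

unique-elements : (D : Subset n) → Unique (elements D)
unique-elements []          = []
unique-elements (true  ∷ D) = All.tabulate zero∉ ∷ Uniqueₚ.map⁺ Finₚ.suc-injective (unique-elements D)
  where
  zero∉ : ∀ {x} → x ∈ map Fin.suc (elements D) → Fin.zero ≢ x
  zero∉ x∈ refl with ∈-map⁻ Fin.suc x∈
  ... | _ , _ , ()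
unique-elements (false ∷ D) = Uniqueₚ.map⁺ Finₚ.suc-injective (unique-elements D)

∈-elements⁺ : (D : Subset n) → ∀ m → lookup D m ≡ true → m ∈ elements D
∈-elements⁺ (true  ∷ D) Fin.zero    _ = here refl
∈-elements⁺ (true  ∷ D) (Fin.suc m) e = there (∈-map⁺ Fin.suc (∈-elements⁺ D m e))
∈-elements⁺ (false ∷ D) (Fin.suc m) e = ∈-map⁺ Fin.suc (∈-elements⁺ D m e)

∈-elements⁻ : (D : Subset n) → ∀ {m} → m ∈ elements D → lookup D m ≡ true
∈-elements⁻ (true  ∷ D) (here refl) = refl
∈-elements⁻ (true  ∷ D) (there p) with ∈-map⁻ Fin.suc p
... | _ , q , refl = ∈-elements⁻ D q
∈-elements⁻ (false ∷ D) p with ∈-map⁻ Fin.suc p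
... | _ , q , refl = ∈-elements⁻ D q

-- Cardinalities are compared through this: any duplicate-free enumeration of `D` is a permutation
-- of the standard one.
unique-length : (D : Subset n) (w : List (Fin n)) → Unique w →
                (∀ {m} → m ∈ w → lookup D m ≡ true) → (∀ m → lookup D m ≡ true → m ∈ w) → length w ≡ ∣ D ∣
unique-length D w uniq sound complete =
  trans (↭-length (unique-↭ uniq (unique-elements D)
          (λ {m} p → ∈-elements⁺ D m (sound p)) (λ {m} p → complete m (∈-elements⁻ D p))))
        (length-elements D)

proper-of-size : (D : Subset n) → ∣ D ∣ < n → Proper D
proper-of-size (false ∷ D) _        = Fin.zero , λ ()
proper-of-size (true  ∷ D) (s≤s lt) with proper-of-size D lt
... | m , m∉D = Fin.suc m , λ { (Vec.there p) → m∉D p }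

-- The word ṽ_A as a sequence of simultaneous steps of all particles.

module Parallel (k : ℕ) (1≤k : 1 ≤ k) where

  open Sites k
  open Exclusion k 1≤k
  open import Data.List.Membership.DecPropositional (_≟_ {suc k}) using (_∈?_)

  -- The effect of letting the particles at the letters of `w` step together. The final content of
  -- the site `nx m` is split by whether a particle enters it, only leaves it, or does neither.
  record Advances (S : State) (w : Word) : Set where
    field
      legal   : Legal S w
      arrived : ∀ {m} → m ∈ w → act S w (nx m) ≡ true
      left    : ∀ {m} → ¬ m ∈ w → nx m ∈ w → act S w (nx m) ≡ false
      kept    : ∀ {m} → ¬ m ∈ w → ¬ nx m ∈ w → act S w (nx m) ≡ S (nx m)

  -- The order condition lets a particle in front move before the one behind it. When `i` hops,
  -- `nx i` does not occur later, so the arrival at `nx i` is final; the vacated site `i` is then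
  -- free for the particle behind.
  advance : ∀ S w → Unique w → AllPairs (λ a b → b ≢ nx a) w → (∀ {m} → m ∈ w → S m ≡ true) →
            (∀ {m} → m ∈ w → ¬ nx m ∈ w → S (nx m) ≡ false) → Advances S w
  advance S [] _ _ _ _ = record { legal = tt ; arrived = λ () ; left = λ _ () ; kept = λ _ _ → refl }
  advance S (i ∷ w) (i# ∷ uniq) (i⁺# ∷ order) full empty = record
    { legal = (full (here refl) , empty-i) , legal ; arrived = arrived′ ; left = left′ ; kept = kept′ }
    where
    i∉ : ¬ i ∈ w
    i∉ p = All.lookup i# p refl
    i⁺∉ : ¬ nx i ∈ w
    i⁺∉ p = All.lookup i⁺# p refl
    outside : ∀ {m} → m ≢ i → ¬ m ∈ w → ¬ m ∈ i ∷ w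
    outside p q (here e)  = p e
    outside p q (there r) = q r
    empty-i : S (nx i) ≡ false
    empty-i = empty (here refl) (outside (nx≢ 1≤k i) i⁺∉)
    full′ : ∀ {m} → m ∈ w → S (τ i m) ≡ true
    full′ p = trans (cong S (τ-fix i (λ { refl → i∉ p }) (λ { refl → i⁺∉ p }))) (full (there p))
    empty′ : ∀ {m} → m ∈ w → ¬ nx m ∈ w → S (τ i (nx m)) ≡ false
    empty′ {m} p q with nx m ≟ i
    ... | yes e = trans (cong S (trans (cong (τ i) e) (τ-left i))) empty-i
    ... | no e  = trans (cong S (τ-fix i e λ e′ → i∉ (subst (_∈ w) (nx-injective e′) p))) (empty (there p) (outside e q))
    open Advances (advance (S ∘ τ i) w uniq order full′ empty′)
    arrived′ : ∀ {m} → m ∈ i ∷ w → act (S ∘ τ i) w (nx m) ≡ true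
    arrived′ (here refl) = trans (kept i∉ i⁺∉) (trans (cong S (τ-right i)) (full (here refl)))
    arrived′ (there p)   = arrived p
    left′ : ∀ {m} → ¬ m ∈ i ∷ w → nx m ∈ i ∷ w → act (S ∘ τ i) w (nx m) ≡ false
    left′ {m} p (here e)  =
      trans (kept (p ∘ there) (subst (λ t → ¬ t ∈ w) (sym e) i∉)) (trans (cong S (trans (cong (τ i) e) (τ-left i))) empty-i)
    left′ p (there q) = left (p ∘ there) q
    kept′ : ∀ {m} → ¬ m ∈ i ∷ w → ¬ nx m ∈ i ∷ w → act (S ∘ τ i) w (nx m) ≡ S (nx m)
    kept′ p q = trans (kept (p ∘ there) (q ∘ there))
      (cong S (τ-fix i (q ∘ here) (p ∘ here ∘ nx-injective)))

  uOrder⇒AllPairs : (w : Word) → (∀ (p q : Fin (length w)) → List.lookup w q ≡ next (suc k) (List.lookup w p) → q Fin.< p) →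
                    AllPairs (λ a b → b ≢ nx a) w
  uOrder⇒AllPairs []      _     = []
  uOrder⇒AllPairs (i ∷ w) order = All.tabulate apart ∷ uOrder⇒AllPairs w (λ p q e → ℕₚ.≤-pred (order (Fin.suc p) (Fin.suc q) e))
    where
    apart : ∀ {b} → b ∈ w → b ≢ nx i
    -- If `nx i` occurred after the first letter `i`, the order would place it at a position below
    -- zero.
    apart p e with order Fin.zero (Fin.suc (index p)) (trans (sym (lookup-index p)) (trans e (nx≡next i)))
    ... | ()

  uOrder-advances : ∀ {D w} → IsUOrder (suc k) D w →
    Legal (lookup D) w × (∀ m → act (lookup D) w (nx m) ≡ lookup D m)
  uOrder-advances {D} {w} (uniq , mem , order) = legal , moved
    where
    in-D : ∀ {m} → m ∈ w → lookup D m ≡ true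
    in-D {m} p = []=⇒lookup (proj₁ (mem m) p)
    in-w : ∀ {m} → lookup D m ≡ true → m ∈ w
    in-w {m} e = proj₂ (mem m) (lookup⇒[]= m D e)
    not-D : ∀ {m} → ¬ m ∈ w → lookup D m ≡ false
    not-D {m} p with lookup D m in eq
    ... | true  = ⊥-elim (p (in-w eq))
    ... | false = refl
    open Advances (advance (lookup D) w uniq (uOrder⇒AllPairs w order) in-D (λ _ → not-D))
    moved : ∀ m → act (lookup D) w (nx m) ≡ lookup D m
    moved m with m ∈? w | nx m ∈? w
    ... | yes p | _     = trans (arrived p) (sym (in-D p))
    ... | no p  | yes q = trans (left p q) (sym (not-D p))
    ... | no p  | no q  = trans (kept p q) (trans (not-D q) (sym (not-D p)))

  lookup-shift : ∀ A d m → lookup (shift (suc k) A d) m ≡ lookup A (ι (+ toℕ m ℤ.- + d))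
  lookup-shift A d m = trans (lookup∘tabulate (λ m → lookup A (intMod (suc k) (+ toℕ m ℤ.- + d))) m)
    (cong (lookup A) (sym (ι≡intMod (+ toℕ m ℤ.- + d))))

  shift-zero : ∀ A m → lookup (shift (suc k) A 0) m ≡ lookup A m
  shift-zero A m = trans (lookup-shift A 0 m) (cong (lookup A) (ι-origin m))

  shift-suc : ∀ A d m → lookup (shift (suc k) A (suc d)) (nx m) ≡ lookup (shift (suc k) A d) m
  shift-suc A d m = trans (lookup-shift A (suc d) (nx m))
    (trans (cong (lookup A) (trans (ι-+ (+ toℕ m ℤ.+ 1ℤ) (ℤ.- + suc d)) (cong ι (cancel (+ toℕ m) (+ d)))))
      (sym (lookup-shift A d m)))
    where
    cancel : ∀ x y → (x ℤ.+ 1ℤ) ℤ.+ ℤ.- (1ℤ ℤ.+ y) ≡ x ℤ.- y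
    cancel = solve-∀

  -- Applying `nx` to an enumeration of A + d enumerates A + (d+1), without repetitions because `nx`
  -- is injective.
  size-shift : ∀ A d → ∣ shift (suc k) A d ∣ ≡ ∣ A ∣
  size-shift A zero    = trans (sym (unique-length (shift (suc k) A 0) (elements A) (unique-elements A)
    (λ {m} p → trans (shift-zero A m) (∈-elements⁻ A p)) (λ m e → ∈-elements⁺ A m (trans (sym (shift-zero A m)) e))))
    (length-elements A)
  size-shift A (suc d) = trans
    (sym (unique-length (shift (suc k) A (suc d)) (map nx (elements D)) (Uniqueₚ.map⁺ nx-injective (unique-elements D)) sound complete))
    (trans (length-map nx (elements D)) (trans (length-elements D) (size-shift A d)))
    where
    D = shift (suc k) A d
    sound : ∀ {m} → m ∈ map nx (elements D) → lookup (shift (suc k) A (suc d)) m ≡ true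
    sound p with ∈-map⁻ nx p
    ... | a , q , refl = trans (shift-suc A d a) (∈-elements⁻ D q)
    complete : ∀ m → lookup (shift (suc k) A (suc d)) m ≡ true → m ∈ map nx (elements D)
    complete m e = subst (_∈ map nx (elements D)) (nx-pv m)
      (∈-map⁺ nx (∈-elements⁺ D (pv m) (trans (sym (shift-suc A d (pv m)))
        (trans (cong (lookup (shift (suc k) A (suc d))) (nx-pv m)) e))))

  record Runs (S : State) (w : Word) (T : State) (l : ℕ) : Set where
    constructor runs
    field
      legal-run   : Legal S w
      final       : act S w ≗ T
      length-run  : length w ≡ l

  module _ (σ : Subset (suc k) → Word) (σ-order : ∀ D → Proper D → IsUOrder (suc k) D (σ D))
           (A : Subset (suc k)) (small : ∣ A ∣ < suc k) where

    private
      sh : ℕ → Subset (suc k)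
      sh = shift (suc k) A

    shift-order : ∀ d → IsUOrder (suc k) (sh d) (σ (sh d))
    shift-order d = σ-order (sh d) (proper-of-size (sh d) (subst (_< suc k) (sym (size-shift A d)) small))

    length-shift : ∀ d → length (σ (sh d)) ≡ ∣ A ∣
    length-shift d = trans (unique-length (sh d) (σ (sh d)) (proj₁ (shift-order d))
      (λ {m} p → []=⇒lookup (proj₁ (proj₁ (proj₂ (shift-order d)) m) p))
      (λ m e → proj₂ (proj₁ (proj₂ (shift-order d)) m) (lookup⇒[]= m (sh d) e))) (size-shift A d)

    -- After the first `d` factors the particles occupy A + d, which is exactly the set of letters
    -- of the next factor. The function `f` generalises the range of exponents, so that the tail of
    -- the product is again an instance.
    shifts-run : ∀ r f d → (∀ t → f t ≡ t + d) → ∀ S → S ≗ lookup (sh d) →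
      Runs S (concat (map (λ e → σ (sh e)) (applyUpTo f r))) (lookup (sh (r + d))) (r * ∣ A ∣)
    shifts-run zero    f d f≡ S S≗ = runs tt S≗ refl
    shifts-run (suc r) f d f≡ S S≗ rewrite f≡ 0 = runs
      (Legal-++ S u v (Legal-cong (sym ∘ S≗) u (proj₁ adv)) (Runs.legal-run rest))
      (λ m → trans (act-++ S u v m) (trans (Runs.final rest m) (cong (λ e → lookup (sh e) m) (ℕₚ.+-suc r d))))
      (trans (length-++ u) (cong₂ _+_ (length-shift d) (Runs.length-run rest)))
      where
      u = σ (sh d)
      v = concat (map (λ e → σ (sh e)) (applyUpTo (f ∘ suc) r))
      adv = uOrder-advances (shift-order d)
      S′≗ : act S u ≗ lookup (sh (suc d))
      S′≗ m = trans (act-cong S≗ u m) (subst (λ x → act (lookup (sh d)) u x ≡ lookup (sh (suc d)) x) (nx-pv m)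
        (trans (proj₂ adv (pv m)) (sym (shift-suc A d (pv m)))))
      rest = shifts-run r (f ∘ suc) (suc d) (λ t → trans (f≡ (suc t)) (sym (ℕₚ.+-suc t d))) (act S u) S′≗

    vtilde-runs : ∀ r → Runs (lookup A) (vtilde k σ r A) (lookup (sh r)) (r * ∣ A ∣)
    vtilde-runs r = subst (λ e → Runs (lookup A) (vtilde k σ r A) (lookup (sh e)) (r * ∣ A ∣)) (ℕₚ.+-identityʳ r)
      (shifts-run r (λ t → t) 0 (λ t → sym (ℕₚ.+-identityʳ t)) (lookup A) (λ m → sym (shift-zero A m)))

-- Row lengths of (R,ν) and decreasing positions.

at-++ˡ : ∀ c r xs {i} → i < r → at (replicate r c ++ xs) (suc i) ≡ c
at-++ˡ c (suc r) xs {zero}  _         = refl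
at-++ˡ c (suc r) xs {suc i} (s≤s i<r) = at-++ˡ c r xs i<r

at-++ʳ : ∀ c r xs i → at (replicate r c ++ xs) (suc (r + i)) ≡ at xs (suc i)
at-++ʳ c zero    xs i = refl
at-++ʳ c (suc r) xs i = at-++ʳ c r xs i

at-beyond : ∀ xs i → at xs (suc (length xs + i)) ≡ 0
at-beyond []       i = refl
at-beyond (x ∷ xs) i = at-beyond xs i

[m+o]∸[n+o]≡m∸n : ∀ m n o → (m + o) ∸ (n + o) ≡ m ∸ n
[m+o]∸[n+o]≡m∸n m n o = trans (cong₂ _∸_ (ℕₚ.+-comm m o) (ℕₚ.+-comm n o)) (ℕₚ.[m+n]∸[m+o]≡n∸o o m n)

Decreasing : ℕ → (ℕ → ℕ) → Set
Decreasing r g = ∀ {i j} → i < j → j < r → g j < g i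

-- Position of the i-th hole of φ(ν), counted from content 1 − 2r; rows are indexed from 0 here.
profile : ∀ {r} → Vec ℕ r → ℕ → ℕ
profile {r} ν i = at (toList ν) (suc i) + (r ∸ suc i)

-- Rows of boxes as moves of a single hole.

module Reading (k : ℕ) (1≤k : 1 ≤ k) where

  open Sites k
  open Exclusion k 1≤k

  κ : ℤ → ℕ → Site
  κ B p = ι (B ℤ.+ + p)

  -- The empty sites of S are exactly those at h 0, …, h (r - 1), counted from content B.
  record Holes (S : State) (B : ℤ) (r : ℕ) (h : ℕ → ℕ) : Set where
    field
      hole : ∀ {i} → i < r → S (κ B (h i)) ≡ false
      only : ∀ m → S m ≡ false → ∃[ i ] (i < r × m ≡ κ B (h i))

  Holes-cong : ∀ {S S′ B B′ r h h′} → S ≗ S′ → (∀ {i} → i < r → κ B (h i) ≡ κ B′ (h′ i)) →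
               Holes S B r h → Holes S′ B′ r h′
  Holes-cong {S} {S′} e eh H = record
    { hole = λ {i} i<r → trans (sym (e _)) (trans (cong S (sym (eh i<r))) (hole i<r))
    ; only = λ m f → let i , i<r , q = only m (trans (e m) f) in i , i<r , trans q (eh i<r) }
    where open Holes H

  Holes-unique : ∀ {S S′ B r h} → Holes S B r h → Holes S′ B r h → S ≗ S′
  Holes-unique {S} {S′} H H′ m with S m in e | S′ m in e′
  ... | true  | true  = refl
  ... | false | false = refl
  ... | true  | false with Holes.only H′ m e′
  ...   | i , i<r , refl = trans (sym e) (Holes.hole H i<r)
  Holes-unique {S} {S′} H H′ m | false | true with Holes.only H m e
  ...   | i , i<r , refl = trans (sym (Holes.hole H′ i<r)) e′

  -- All holes other than `i` avoid the positions from `lo` to `hi`. They also stay inside the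
  -- window, so that distinct positions are distinct sites.
  Elsewhere : ℕ → (ℕ → ℕ) → ℕ → ℕ → ℕ → Set
  Elsewhere r h i lo hi = ∀ {j} → j < r → j ≢ i → h j < suc k × (h j < lo ⊎ hi < h j)

  -- A particle stepping from `p` to `p + 1` is a hole stepping back from `p + 1` to `p`. As no
  -- other hole is at either position, `p` is occupied beforehand and the remaining holes are
  -- untouched.
  hop : ∀ {S B r h h′ i p} → Holes S B r h → i < r → h i ≡ suc p → suc p < suc k →
        Elsewhere r h i p (suc p) → h′ i ≡ p → (∀ {j} → j < r → j ≢ i → h′ j ≡ h j) →
        (S (κ B p) ≡ true × S (nx (κ B p)) ≡ false) × Holes (S ∘ τ (κ B p)) B r h′
  hop {S} {B} {r} {h} {h′} {i} {p} H i<r hi p⁺<n free h′i h′j = (full , empty) , record { hole = hole′ ; only = only′ }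
    where
    open Holes H
    p<n : p < suc k
    p<n = ℕₚ.<-trans (ℕₚ.n<1+n p) p⁺<n
    h≢p : ∀ {j} → j < r → p ≢ h j
    h≢p {j} j<r e with j ℕ.≟ i
    ... | yes refl = ℕₚ.1+n≢n (sym (trans e hi))
    ... | no j≢i with proj₂ (free j<r j≢i)
    ...   | inj₁ lt = ℕₚ.<-irrefl (sym e) lt
    ...   | inj₂ gt = ℕₚ.<-irrefl e (ℕₚ.<-trans (ℕₚ.n<1+n p) gt)
    h≢p⁺ : ∀ {j} → j < r → j ≢ i → suc p ≢ h j
    h≢p⁺ j<r j≢i e with proj₂ (free j<r j≢i)
    ... | inj₁ lt = ℕₚ.<-irrefl (sym e) (ℕₚ.<-trans lt (ℕₚ.n<1+n p))
    ... | inj₂ gt = ℕₚ.<-irrefl e gt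
    h<n : ∀ {j} → j < r → h j < suc k
    h<n {j} j<r with j ℕ.≟ i
    ... | yes refl = subst (_< suc k) (sym hi) p⁺<n
    ... | no j≢i   = proj₁ (free j<r j≢i)
    empty : S (nx (κ B p)) ≡ false
    empty = trans (cong S (trans (sym (ι-suc B p)) (cong (κ B) (sym hi)))) (hole i<r)
    full : S (κ B p) ≡ true
    full with S (κ B p) in e
    ... | true  = refl
    ... | false = let j , j<r , q = only _ e in ⊥-elim (h≢p j<r (ι-injective B p<n (h<n j<r) q))
    hole′ : ∀ {j} → j < r → S (τ (κ B p) (κ B (h′ j))) ≡ false
    hole′ {j} j<r with j ℕ.≟ i
    ... | yes refl = trans (cong (λ x → S (τ (κ B p) (κ B x))) h′i) (trans (cong S (τ-left _)) empty)
    ... | no j≢i   = trans (cong (λ x → S (τ (κ B p) (κ B x))) (h′j j<r j≢i))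
      (trans (cong S (τ-fix _ (λ e → h≢p j<r (ι-injective B p<n (h<n j<r) (sym e)))
                              (λ e → h≢p⁺ j<r j≢i (ι-injective B p⁺<n (h<n j<r) (trans (ι-suc B p) (sym e))))))
             (hole j<r))
    only′ : ∀ m → S (τ (κ B p) m) ≡ false → ∃[ j ] (j < r × m ≡ κ B (h′ j))
    only′ m f with m ≟ κ B p | m ≟ nx (κ B p)
    ... | yes e | _      = i , i<r , trans e (cong (κ B) (sym h′i))
    ... | no _  | yes e = ⊥-elim (true≢false full (trans (cong S (sym (trans (cong (τ _) e) (τ-right _)))) f))
    ... | no a  | no b  with only m (trans (cong S (sym (τ-fix _ a b))) f)
    ...   | j , j<r , q with j ℕ.≟ i
    ...     | yes refl = ⊥-elim (b (trans q (trans (cong (κ B) hi) (ι-suc B p))))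
    ...     | no j≢i   = j , j<r , trans q (cong (κ B) (sym (h′j j<r j≢i)))

  -- The letters at positions `b + t - 1` down to `b`, which take a hole from `b + t` to `b`.
  down : ℤ → ℕ → ℕ → Word
  down B b zero    = []
  down B b (suc t) = κ B (b + t) ∷ down B b t

  length-down : ∀ B b t → length (down B b t) ≡ t
  length-down B b zero    = refl
  length-down B b (suc t) = cong suc (length-down B b t)

  update : (ℕ → ℕ) → ℕ → ℕ → ℕ → ℕ
  update h i v j with j ℕ.≟ i
  ... | yes _ = v
  ... | no _  = h j

  update-≡ : ∀ h i v → update h i v i ≡ v
  update-≡ h i v with i ℕ.≟ i
  ... | yes _ = refl
  ... | no p  = ⊥-elim (p refl)

  update-≢ : ∀ h i v {j} → j ≢ i → update h i v j ≡ h j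
  update-≢ h i v {j} j≢i with j ℕ.≟ i
  ... | yes p = ⊥-elim (j≢i p)
  ... | no _  = refl

  slide : ∀ {S B r h h′ i b} t → Holes S B r h → i < r → h i ≡ b + t → b + t < suc k →
          Elsewhere r h i b (b + t) → h′ i ≡ b → (∀ {j} → j < r → j ≢ i → h′ j ≡ h j) →
          Legal S (down B b t) × Holes (act S (down B b t)) B r h′
  slide {S} {B} {r} {h} {h′} {i} {b} zero H i<r hi _ _ h′i h′j = tt , Holes-cong (λ _ → refl) same H
    where
    same : ∀ {j} → j < r → κ B (h j) ≡ κ B (h′ j)
    same {j} j<r with j ℕ.≟ i
    ... | yes refl = cong (κ B) (trans hi (trans (ℕₚ.+-identityʳ b) (sym h′i)))
    ... | no j≢i   = cong (κ B) (sym (h′j j<r j≢i))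
  slide {S} {B} {r} {h} {h′} {i} {b} (suc t) H i<r hi <n free h′i h′j = (proj₁ first , proj₁ rest) , proj₂ rest
    where
    b⁺ : b + suc t ≡ suc (b + t)
    b⁺ = ℕₚ.+-suc b t
    mid : ℕ → ℕ
    mid = update h i (b + t)
    first = hop {h′ = mid} H i<r (trans hi b⁺) (subst (_< suc k) b⁺ <n)
      (λ j<r j≢i → proj₁ (free j<r j≢i) , widen (proj₂ (free j<r j≢i)))
      (update-≡ h i (b + t)) (λ _ j≢i → update-≢ h i (b + t) j≢i)
      where
      widen : ∀ {x} → x < b ⊎ b + suc t < x → x < b + t ⊎ suc (b + t) < x
      widen (inj₁ lt) = inj₁ (ℕₚ.≤-trans lt (ℕₚ.m≤m+n b t))
      widen {x} (inj₂ gt) = inj₂ (subst (_< x) b⁺ gt)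
    narrow : ∀ {x} → x < b ⊎ b + suc t < x → x < b ⊎ b + t < x
    narrow (inj₁ lt) = inj₁ lt
    narrow {x} (inj₂ gt) = inj₂ (ℕₚ.<-trans (ℕₚ.n<1+n (b + t)) (subst (_< x) b⁺ gt))
    rest = slide {h′ = h′} t (proj₂ first) i<r (update-≡ h i (b + t)) (ℕₚ.<-trans (ℕₚ.n<1+n _) (subst (_< suc k) b⁺ <n))
      (λ {j} j<r j≢i → subst (λ x → x < suc k × (x < b ⊎ b + t < x)) (sym (update-≢ h i (b + t) j≢i))
                  (proj₁ (free j<r j≢i) , narrow (proj₂ (free j<r j≢i))))
      h′i (λ j<r j≢i → trans (h′j j<r j≢i) (sym (update-≢ h i (b + t) j≢i)))

  -- Rows are read from the last one up, so the holes with index ≥ i are the ones already moved.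
  stage : (a b : ℕ → ℕ) → ℕ → ℕ → ℕ
  stage a b i j with j ℕ.<? i
  ... | yes _ = a j
  ... | no _  = b j

  stage-< : ∀ a b {i j} → j < i → stage a b i j ≡ a j
  stage-< a b {i} {j} lt with j ℕ.<? i
  ... | yes _ = refl
  ... | no p  = ⊥-elim (p lt)

  stage-≥ : ∀ a b {i j} → i ≤ j → stage a b i j ≡ b j
  stage-≥ a b {i} {j} le with j ℕ.<? i
  ... | yes p = ⊥-elim (ℕₚ.<⇒≱ p le)
  ... | no _  = refl

  -- Hole `i` is to be moved from `a i` down to `b i`; both sequences decrease, so the holes never
  -- have to pass each other.
  record Lowering (r : ℕ) (a b : ℕ → ℕ) : Set where
    field
      a<n   : ∀ {i} → i < r → a i < suc k
      b≤a   : ∀ {i} → i < r → b i ≤ a i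
      a-dec : Decreasing r a
      b-dec : Decreasing r b

  -- The way is free: holes of smaller index still sit above `a i`, and those of larger index have
  -- already gone below `b i`.
  lower-one : ∀ {S B r a b i} → Lowering r a b → i < r → Holes S B r (stage a b (suc i)) →
              Legal S (down B (b i) (a i ∸ b i)) × Holes (act S (down B (b i) (a i ∸ b i))) B r (stage a b i)
  lower-one {S} {B} {r} {a} {b} {i} L i<r H = slide (a i ∸ b i) H i<r
      (trans (stage-< a b (ℕₚ.n<1+n i)) (sym top)) (subst (_< suc k) (sym top) (a<n i<r))
      elsewhere (stage-≥ a b ℕₚ.≤-refl) agree
    where
    open Lowering L
    top : b i + (a i ∸ b i) ≡ a i
    top = ℕₚ.m+[n∸m]≡n (b≤a i<r)
    elsewhere : Elsewhere r (stage a b (suc i)) i (b i) (b i + (a i ∸ b i))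
    elsewhere {j} j<r j≢i with ℕₚ.<-cmp j i
    ... | tri≈ _ e _ = ⊥-elim (j≢i e)
    ... | tri< lt _ _ = subst (λ x → x < suc k × (x < b i ⊎ b i + (a i ∸ b i) < x)) (sym (stage-< a b (ℕₚ.m<n⇒m<1+n lt)))
      (a<n j<r , inj₂ (subst (_< a j) (sym top) (a-dec lt i<r)))
    ... | tri> _ _ gt = subst (λ x → x < suc k × (x < b i ⊎ b i + (a i ∸ b i) < x)) (sym (stage-≥ a b gt))
      (ℕₚ.≤-<-trans (b≤a j<r) (a<n j<r) , inj₁ (b-dec gt j<r))
    agree : ∀ {j} → j < r → j ≢ i → stage a b i j ≡ stage a b (suc i) j
    agree {j} j<r j≢i with ℕₚ.<-cmp j i
    ... | tri≈ _ e _ = ⊥-elim (j≢i e)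
    ... | tri< lt _ _ = trans (stage-< a b lt) (sym (stage-< a b (ℕₚ.m<n⇒m<1+n lt)))
    ... | tri> _ _ gt = trans (stage-≥ a b (ℕₚ.<⇒≤ gt)) (sym (stage-≥ a b gt))

  -- The content of the first box of row `N`, before reduction. For `N` = 2r it is the constant in
  -- the definition of φ.
  base : ℕ → ℤ
  base N = 1ℤ ℤ.- + N

  -- The last box read has content `1 + m - R`, and the offset `s` cancels from base and position.
  -- Choosing `s` suitably puts all rows of one half of the shape into the same window.
  rowWord-down : ∀ R l m s → rowWord k R l m ≡ down (base (R + s)) (m + s) (l ∸ m)
  rowWord-down R zero    m s rewrite ℕₚ.0∸n≡0 m = refl
  rowWord-down R (suc l) m s with m ℕ.≤? l
  ... | no m≰l rewrite ℕₚ.m≤n⇒m∸n≡0 (ℕₚ.≰⇒> m≰l) = refl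
  ... | yes m≤l rewrite ℕₚ.+-∸-assoc 1 m≤l = cong₂ _∷_ head
      (trans (trans (map-applyUpTo suc (λ t → content k R (suc l ∸ t)) (l ∸ m))
                    (sym (map-upTo (λ t → content k R (l ∸ t)) (l ∸ m))))
             (rowWord-down R l m s))
    where
    head : content k R (suc l) ≡ κ (base (R + s)) (m + s + (l ∸ m))
    head = trans (sym (ι≡intMod (+ suc l ℤ.- + R))) (cong ι (trans (rearrange (+ l) (+ R) (+ s))
      (cong (λ x → base (R + s) ℤ.+ + x)
        (trans (cong (ℕ._+ s) (sym (ℕₚ.m+[n∸m]≡n m≤l))) (xy∙z≈xz∙y m (l ∸ m) s)))))
      where
      rearrange : ∀ l R s → (1ℤ ℤ.+ l) ℤ.- R ≡ (1ℤ ℤ.- (R ℤ.+ s)) ℤ.+ (l ℤ.+ s)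
      rearrange = solve-∀

  -- Rows `N`, ..., 1, the part of the reading word that remains once the rows after row `N` have
  -- been read.
  rowsBelow : List ℕ → List ℕ → ℕ → Word
  rowsBelow λs μs N = concat (map (λ i → rowWord k i (at λs i) (at μs i)) (applyDownFrom suc N))

  readWord-rows : ∀ λs μs → readWord k λs μs ≡ rowsBelow λs μs (length λs)
  readWord-rows λs μs = cong (λ is → concat (map (λ i → rowWord k i (at λs i) (at μs i)) is))
    (trans (cong reverse (map-upTo suc (length λs))) (reverse-applyUpTo suc (length λs)))

  -- The reading word of (R,ν)/ν: its legality, final state and length.

  module Rows (c r : ℕ) (c+r≡n : c + r ≡ suc k) (ν : Vec ℕ r)
           (part≤c : ∀ i → at (toList ν) (suc i) ≤ c)
           (part-dec : ∀ {i j} → i < j → j < r → at (toList ν) (suc j) ≤ at (toList ν) (suc i)) where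

    private
      λs = RNu c r ν
      μs = toList ν
      p : ℕ → ℕ
      p i = at (toList ν) (suc i)
      s : ℕ → ℕ
      s i = r ∸ suc i
      h : ℕ → ℕ
      h = profile ν

    s-dec : Decreasing r s
    s-dec i<j j<r = ℕₚ.∸-monoʳ-< (s≤s i<j) j<r

    s<r : ∀ {i} → i < r → s i < r
    s<r i<r = ℕₚ.∸-monoʳ-< (s≤s z≤n) i<r

    c+s<n : ∀ {i} → i < r → c + s i < suc k
    c+s<n {i} i<r = subst (c + s i <_) c+r≡n (ℕₚ.+-monoʳ-< c (s<r i<r))

    profile-dec : Decreasing r h
    profile-dec i<j j<r = ℕₚ.+-mono-≤-< (part-dec i<j j<r) (s-dec i<j j<r)

    profile≤ : ∀ i → h i ≤ c + s i
    profile≤ i = ℕₚ.+-monoˡ-≤ (s i) (part≤c i)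

    -- Rows r+1 to 2r are the rows of ν: the row of part `p i` has `p i = h i - s i` boxes and takes
    -- hole `i` to the staircase position `s i`.
    lower-half : Lowering r h s
    lower-half = record
      { a<n   = λ {i} i<r → ℕₚ.≤-<-trans (profile≤ i) (c+s<n i<r)
      ; b≤a   = λ {i} _ → ℕₚ.m≤n+m (s i) (p i)
      ; a-dec = profile-dec
      ; b-dec = s-dec }

    -- Rows 1 to r are those of R/ν: the row of part `p i` has `c - p i` boxes and takes hole `i`
    -- from `c + s i` back to its profile position.
    upper-half : Lowering r (λ i → c + s i) h
    upper-half = record
      { a<n   = c+s<n
      ; b≤a   = λ {i} _ → profile≤ i
      ; a-dec = λ i<j j<r → ℕₚ.+-monoʳ-< c (s-dec i<j j<r)
      ; b-dec = profile-dec }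

    upper-row : ∀ {i} → i < r → rowWord k (suc i) (at λs (suc i)) (at μs (suc i)) ≡
                                down (base r) (h i) ((c + s i) ∸ h i)
    upper-row {i} i<r rewrite at-++ˡ c r μs i<r =
      trans (rowWord-down (suc i) c (p i) (s i))
        (cong₂ (λ N t → down (base N) (h i) t) (ℕₚ.m+[n∸m]≡n i<r)
               (sym ([m+o]∸[n+o]≡m∸n c (p i) (s i))))

    beyond : ∀ i → at μs (suc (r + i)) ≡ 0
    beyond i = subst (λ l → at μs (suc (l + i)) ≡ 0) (length-toList ν) (at-beyond μs i)

    lower-row : ∀ {i} → i < r → rowWord k (suc (r + i)) (at λs (suc (r + i))) (at μs (suc (r + i))) ≡
                                down (base (r + r)) (s i) (h i ∸ s i)
    lower-row {i} i<r rewrite at-++ʳ c r μs i | beyond i =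
      trans (rowWord-down (suc (r + i)) (p i) 0 (s i))
        (cong₂ (λ N t → down (base N) (s i) t)
          (trans (cong (ℕ._+ s i) (sym (ℕₚ.+-suc r i))) (trans (ℕₚ.+-assoc r (suc i) (s i)) (cong (ℕ._+_ r) (ℕₚ.m+[n∸m]≡n i<r))))
          (sym (ℕₚ.m+n∸n≡m (p i) (s i))))

    rows-++ : ∀ i {w} → rowWord k (suc i) (at λs (suc i)) (at μs (suc i)) ≡ w →
              rowsBelow λs μs (suc i) ≡ w ++ rowsBelow λs μs i
    rows-++ i e = cong (_++ rowsBelow λs μs i) e

    Clears : State → Word → Set
    Clears S w = Legal S w × Holes (act S w) (base r) r h

    prepend : ∀ {S u v w} → w ≡ u ++ v → Legal S u → Clears (act S u) v → Clears S w
    prepend {S} {u} {v} refl lu (lv , H) =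
      Legal-++ S u v lu lv , Holes-cong (sym ∘ act-++ S u v) (λ _ → refl) H

    upper-clears : ∀ {S} i → i ≤ r → Holes S (base r) r (stage (λ i → c + s i) h i) →
                   Clears S (rowsBelow λs μs i)
    upper-clears zero    _   H = tt , Holes-cong (λ _ → refl) (λ _ → cong (κ (base r)) (stage-≥ (λ i → c + s i) h z≤n)) H
    upper-clears (suc i) i<r H = prepend (rows-++ i (upper-row i<r)) (proj₁ one) (upper-clears i (ℕₚ.<⇒≤ i<r) (proj₂ one))
      where
      one = lower-one upper-half i<r H

    -- The integers differ by c + r, one full turn. The holes left by the lower half are thus the
    -- ones with which the upper half starts, in a window moved by r.
    once-around : ∀ i → κ (base (r + r)) (s i) ≡ κ (base r) (c + s i)
    once-around i = trans (sym (ι-periodic (base (r + r) ℤ.+ + s i)))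
      (cong ι (trans (cong (λ n → base (r + r) ℤ.+ + s i ℤ.+ + n) (sym c+r≡n)) (rearrange (+ c) (+ r) (+ s i))))
      where
      rearrange : ∀ c r s → (1ℤ ℤ.- (r ℤ.+ r)) ℤ.+ s ℤ.+ (c ℤ.+ r) ≡ (1ℤ ℤ.- r) ℤ.+ (c ℤ.+ s)
      rearrange = solve-∀

    lower-clears : ∀ {S} i → i ≤ r → Holes S (base (r + r)) r (stage h s i) →
                   Clears S (rowsBelow λs μs (r + i))
    lower-clears {S} zero _ H = subst (λ N → Clears S (rowsBelow λs μs N)) (sym (ℕₚ.+-identityʳ r))
      (upper-clears r ℕₚ.≤-refl (Holes-cong (λ _ → refl)
        (λ {i} i<r → trans (cong (κ (base (r + r))) (stage-≥ h s z≤n))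
          (trans (once-around i) (cong (κ (base r)) (sym (stage-< _ h i<r))))) H))
    lower-clears {S} (suc i) i<r H = subst (λ N → Clears S (rowsBelow λs μs N)) (sym (ℕₚ.+-suc r i))
      (prepend (rows-++ (r + i) (lower-row i<r)) (proj₁ one) (lower-clears i (ℕₚ.<⇒≤ i<r) (proj₂ one)))
      where
      one = lower-one lower-half i<r H

    -- Row r+i+1 has ν_{i+1} boxes and row i+1 has c - ν_{i+1}, so each pair adds c. Counting the
    -- upper rows on both sides avoids a separate sum of parts; they cancel at `i` = `r`.
    length-rows : ∀ i → i ≤ r → length (rowsBelow λs μs (r + i)) + length (rowsBelow λs μs i) ≡
                                i * c + length (rowsBelow λs μs r)
    length-rows zero _ = trans (ℕₚ.+-identityʳ _) (cong (λ N → length (rowsBelow λs μs N)) (ℕₚ.+-identityʳ r))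
    length-rows (suc i) i<r rewrite ℕₚ.+-suc r i = begin
      length (rowsBelow λs μs (suc (r + i))) + length (rowsBelow λs μs (suc i))
        ≡⟨ cong₂ _+_ (cong length (rows-++ (r + i) (lower-row i<r))) (cong length (rows-++ i (upper-row i<r))) ⟩
      length (down (base (r + r)) (s i) (h i ∸ s i) ++ rowsBelow λs μs (r + i)) +
      length (down (base r) (h i) ((c + s i) ∸ h i) ++ rowsBelow λs μs i)
        ≡⟨ cong₂ _+_ (length-++ (down (base (r + r)) (s i) (h i ∸ s i))) (length-++ (down (base r) (h i) ((c + s i) ∸ h i))) ⟩
      (length (down (base (r + r)) (s i) (h i ∸ s i)) + length (rowsBelow λs μs (r + i))) +
      (length (down (base r) (h i) ((c + s i) ∸ h i)) + length (rowsBelow λs μs i))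
        ≡⟨ cong₂ (λ x y → (x + length (rowsBelow λs μs (r + i))) + (y + length (rowsBelow λs μs i)))
             (trans (length-down _ _ _) (ℕₚ.m+n∸n≡m (p i) (s i)))
             (trans (length-down _ _ _) ([m+o]∸[n+o]≡m∸n c (p i) (s i))) ⟩
      (p i + length (rowsBelow λs μs (r + i))) + ((c ∸ p i) + length (rowsBelow λs μs i))
        ≡⟨ interchange (p i) _ (c ∸ p i) _ ⟩
      (p i + (c ∸ p i)) + (length (rowsBelow λs μs (r + i)) + length (rowsBelow λs μs i))
        ≡⟨ cong₂ _+_ (ℕₚ.m+[n∸m]≡n (part≤c i)) (length-rows i (ℕₚ.<⇒≤ i<r)) ⟩
      c + (i * c + length (rowsBelow λs μs r))
        ≡⟨ ℕₚ.+-assoc c (i * c) _ ⟨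
      suc i * c + length (rowsBelow λs μs r) ∎
      where
      open ≡-Reasoning

    Vword-rows : Vword k c r ν ≡ rowsBelow λs μs (r + r)
    Vword-rows = trans (readWord-rows λs μs) (cong (rowsBelow λs μs)
      (trans (length-++ (replicate r c)) (cong₂ _+_ (length-replicate r) (length-toList ν))))

    Vword-clears : ∀ {S} → Holes S (base (r + r)) r h → Clears S (Vword k c r ν)
    Vword-clears {S} H = subst (Clears S) (sym Vword-rows)
      (lower-clears r ℕₚ.≤-refl (Holes-cong (λ _ → refl) (λ i<r → cong (κ (base (r + r))) (sym (stage-< h s i<r))) H))

    length-Vword : length (Vword k c r ν) ≡ r * c
    length-Vword = trans (cong length Vword-rows)
      (ℕₚ.+-cancelʳ-≡ (length (rowsBelow λs μs r)) _ _ (length-rows r ℕₚ.≤-refl))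

-- Subsets given by lists, and strictly decreasing sequences.

lookup-ext : {u v : Vec X n} → lookup u ≗ lookup v → u ≡ v
lookup-ext {u = u} {v} e = trans (sym (tabulate∘lookup u)) (trans (tabulate-cong e) (tabulate∘lookup v))

unique-map : ∀ {Y : Set} (f : X → Y) {xs} → (∀ {x y} → x ∈ xs → y ∈ xs → f x ≡ f y → x ≡ y) →
             Unique xs → Unique (map f xs)
unique-map f inj []        = []
unique-map f {x ∷ xs} inj (x# ∷ uniq) = All.tabulate apart ∷ unique-map f (λ p q → inj (there p) (there q)) uniq
  where
  apart : ∀ {m} → m ∈ map f xs → f x ≢ m
  apart p e with ∈-map⁻ f p
  ... | y , y∈ , refl = All.lookup x# y∈ (inj (here refl) (there y∈) e)

toSubset⁺ : ∀ {m : Fin n} l → m ∈ l → m ∈ₛ toSubset l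
toSubset⁺ (x ∷ l) (here refl) = x∈p∪q⁺ (inj₁ (x∈⁅x⁆ x))
toSubset⁺ (x ∷ l) (there p)   = x∈p∪q⁺ (inj₂ (toSubset⁺ l p))

toSubset⁻ : ∀ {m : Fin n} l → m ∈ₛ toSubset l → m ∈ l
toSubset⁻ []      p = ⊥-elim (∉⊥ p)
toSubset⁻ (x ∷ l) p with x∈p∪q⁻ _ (toSubset l) p
... | inj₁ q = here (x∈⁅y⁆⇒x≡y x q)
... | inj₂ q = there (toSubset⁻ l q)

∉⇒false : ∀ (D : Subset n) {m} → m ∉ D → lookup D m ≡ false
∉⇒false D {m} p with lookup D m in e
... | true  = ⊥-elim (p (lookup⇒[]= m D e))
... | false = refl

false⇒∉ : ∀ (D : Subset n) {m} → lookup D m ≡ false → m ∉ D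
false⇒∉ D e p with trans (sym ([]=⇒lookup p)) e
... | ()

at-toList : ∀ (ν : Vec ℕ n) {i} (i<n : i < n) → at (toList ν) (suc i) ≡ lookup ν (fromℕ< i<n)
at-toList (x ∷ ν) {zero}  (s≤s _)   = refl
at-toList (x ∷ ν) {suc i} (s≤s i<n) = at-toList ν i<n

at-toList-≥ : ∀ (ν : Vec ℕ n) {i} → n ≤ i → at (toList ν) (suc i) ≡ 0
at-toList-≥ []      _         = refl
at-toList-≥ (x ∷ ν) (s≤s n≤i) = at-toList-≥ ν n≤i

at-∈ : ∀ xs {i} → i < length xs → at xs (suc i) ∈ xs
at-∈ (x ∷ xs) {zero}  _        = here refl
at-∈ (x ∷ xs) {suc i} (s≤s lt) = there (at-∈ xs lt)

∈-at : ∀ {xs x} → x ∈ xs → ∃[ i ] (i < length xs × x ≡ at xs (suc i))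
∈-at (here refl) = 0 , s≤s z≤n , refl
∈-at (there p)   = let i , lt , e = ∈-at p in suc i , s≤s lt , e

at-pairs : ∀ {R : ℕ → ℕ → Set} {xs} → AllPairs R xs → ∀ {i j} → i < j → j < length xs →
           R (at xs (suc i)) (at xs (suc j))
at-pairs {xs = x ∷ xs} (px ∷ _)  {zero}  {suc j} _         (s≤s lt) = All.lookup px (at-∈ xs lt)
at-pairs {xs = x ∷ xs} (_  ∷ ps) {suc i} {suc j} (s≤s i<j) (s≤s lt) = at-pairs ps i<j lt

Decreasing-≤ : ∀ {r g i j} → Decreasing r g → i ≤ j → j < r → g j ≤ g i
Decreasing-≤ dec i≤j j<r with ℕₚ.m≤n⇒m<n∨m≡n i≤j
... | inj₁ i<j  = ℕₚ.<⇒≤ (dec i<j j<r)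
... | inj₂ refl = ℕₚ.≤-refl

decreasing-gap : ∀ {r g} → Decreasing r g → ∀ i d → i + d < r → g (i + d) + d ≤ g i
decreasing-gap {g = g} dec i zero    _  = ℕₚ.≤-reflexive (trans (ℕₚ.+-identityʳ _) (cong g (ℕₚ.+-identityʳ i)))
decreasing-gap {r} {g} dec i (suc d) lt = begin
  g (i + suc d) + suc d   ≡⟨ ℕₚ.+-suc (g (i + suc d)) d ⟩
  suc (g (i + suc d)) + d ≤⟨ ℕₚ.+-monoˡ-≤ d (dec (ℕₚ.+-monoʳ-< i (ℕₚ.n<1+n d)) lt) ⟩
  g (i + d) + d           ≤⟨ decreasing-gap dec i d (ℕₚ.<-trans (ℕₚ.+-monoʳ-< i (ℕₚ.n<1+n d)) lt) ⟩
  g i                     ∎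
  where open ℕₚ.≤-Reasoning

-- Strong induction on the index: `g i` equals some `g′ j`, and `j < i` would repeat an earlier
-- value of `g`. So `j` is at least `i`, which gives `g i ≤ g′ i`; the other inequality is
-- symmetric.
decreasing-unique : ∀ {r g g′} → Decreasing r g → Decreasing r g′ →
                    (∀ {i} → i < r → ∃[ j ] (j < r × g i ≡ g′ j)) →
                    (∀ {i} → i < r → ∃[ j ] (j < r × g′ i ≡ g j)) → ∀ i → i < r → g i ≡ g′ i
decreasing-unique {r} {g} {g′} dec dec′ to from = <-rec (λ i → i < r → g i ≡ g′ i) λ i rec i<r →
  ℕₚ.≤-antisym (below dec dec′ to i<r λ {j} j<i → rec j<i (ℕₚ.<-trans j<i i<r))
               (below dec′ dec from i<r λ {j} j<i → sym (rec j<i (ℕₚ.<-trans j<i i<r)))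
  where
  below : ∀ {g g′} → Decreasing r g → Decreasing r g′ → (∀ {i} → i < r → ∃[ j ] (j < r × g i ≡ g′ j)) →
          ∀ {i} → i < r → (∀ {j} → j < i → g j ≡ g′ j) → g i ≤ g′ i
  below dec dec′ to {i} i<r rec with to i<r
  ... | j , j<r , e with ℕₚ.<-≤-connex j i
  ...   | inj₁ j<i = ⊥-elim (ℕₚ.<-irrefl (trans e (sym (rec j<i))) (dec j<i i<r))
  ...   | inj₂ i≤j = subst (_≤ _) (sym e) (Decreasing-≤ dec′ i≤j j<r)

-- The holes of φ(ν) and the bijection between partitions in R and c-subsets.

module Holey (k : ℕ) (1≤k : 1 ≤ k) where

  open Sites k
  open Exclusion k 1≤k
  open Reading k 1≤k

  Holes-size : ∀ {D B r h} → Holes (lookup D) B r h → (∀ {i} → i < r → h i < suc k) → Decreasing r h → ∣ ∁ D ∣ ≡ r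
  Holes-size {D} {B} {r} {h} H h<n dec = trans (sym (unique-length (∁ D) (List.applyUpTo (κ B ∘ h) r) uniq sound complete))
      (List-length r)
    where
    open Holes H
    uniq : Unique (List.applyUpTo (κ B ∘ h) r)
    uniq = Uniqueₚ.applyUpTo⁺₁ (κ B ∘ h) r λ i<j j<r e →
      ℕₚ.<-irrefl (sym (ι-injective B (h<n (ℕₚ.<-trans i<j j<r)) (h<n j<r) e)) (dec i<j j<r)
    sound : ∀ {m} → m ∈ List.applyUpTo (κ B ∘ h) r → lookup (∁ D) m ≡ true
    sound p with ∈-applyUpTo⁻ (κ B ∘ h) p
    ... | i , i<r , refl = []=⇒lookup (x∉p⇒x∈∁p (false⇒∉ D (hole i<r)))
    complete : ∀ m → lookup (∁ D) m ≡ true → m ∈ List.applyUpTo (κ B ∘ h) r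
    complete m e with only m (∉⇒false D (x∈∁p⇒x∉p (lookup⇒[]= m (∁ D) e)))
    ... | i , i<r , refl = ∈-applyUpTo⁺ (κ B ∘ h) i<r
    List-length : ∀ r → length (List.applyUpTo (κ B ∘ h) r) ≡ r
    List-length = length-applyUpTo (κ B ∘ h)

  module _ (c r : ℕ) (c+r≡n : c + r ≡ suc k) where

    ∁-size : ∀ {D} → ∣ ∁ D ∣ ≡ r → ∣ D ∣ ≡ c
    ∁-size {D} e = ℕₚ.+-cancelʳ-≡ r _ _ (trans (cong (ℕ._+_ ∣ D ∣) (trans (sym e) (∣∁p∣≡n∸∣p∣ D)))
      (trans (ℕₚ.m+[n∸m]≡n (∣p∣≤n D)) (sym c+r≡n)))

    part≤c : ∀ {ν} → InBox c r ν → ∀ i → at (toList ν) (suc i) ≤ c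
    part≤c {ν} (≤c , _) i with i ℕ.<? r
    ... | yes i<r = subst (_≤ c) (sym (at-toList ν i<r)) (≤c (fromℕ< i<r))
    ... | no i≮r  = subst (_≤ c) (sym (at-toList-≥ ν (ℕₚ.≮⇒≥ i≮r))) z≤n

    part-dec : ∀ {ν} → InBox c r ν → ∀ {i j} → i < j → j < r → at (toList ν) (suc j) ≤ at (toList ν) (suc i)
    part-dec {ν} (_ , dec) {i} {j} i<j j<r = subst₂ _≤_ (sym (at-toList ν j<r)) (sym (at-toList ν i<r))
      (dec (fromℕ< i<r) (fromℕ< j<r) (subst₂ _≤_ (sym (Finₚ.toℕ-fromℕ< i<r)) (sym (Finₚ.toℕ-fromℕ< j<r)) (ℕₚ.<⇒≤ i<j)))
      where
      i<r = ℕₚ.<-trans i<j j<r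

    module Partition {ν : Vec ℕ r} (box : InBox c r ν) where

      open Rows c r c+r≡n ν (part≤c {ν} box) (part-dec {ν} box) public

      profile<n : ∀ {i} → i < r → profile ν i < suc k
      profile<n = Lowering.a<n lower-half

      -- The position of the right end of block q of φ(ν); the left end is 1 + edge (suc q), or 0 for q = r.
      edge : ℕ → ℕ
      edge q = part c r ν q + (r ∸ q)

      start : ℕ → ℕ
      start q = part c r ν (suc q) + (r ∸ q)

      start-suc : ∀ {q} → q < r → start q ≡ suc (profile ν q)
      start-suc {q} q<r = trans (cong (ℕ._+_ (part c r ν (suc q))) (ℕₚ.+-∸-assoc 1 q<r)) (ℕₚ.+-suc _ (r ∸ suc q))

      start-last : start r ≡ 0
      start-last = cong₂ _+_ (at-toList-≥ ν ℕₚ.≤-refl) (ℕₚ.n∸n≡0 r)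

      edge≤n : ∀ {q} → q ≤ r → edge q ≤ suc k
      edge≤n {zero}  _   = ℕₚ.≤-reflexive c+r≡n
      edge≤n {suc q} q≤r = ℕₚ.<⇒≤ (profile<n q≤r)

      part-step : ∀ q → part c r ν (suc q) ≤ part c r ν q
      part-step zero    = part≤c {ν} box 0
      part-step (suc q) with suc q ℕ.<? r
      ... | yes q<r = part-dec {ν} box (ℕₚ.n<1+n q) q<r
      ... | no q≮r  = subst (_≤ at (toList ν) (suc q)) (sym (at-toList-≥ ν (ℕₚ.≮⇒≥ q≮r))) z≤n

      InBlock : Site → ℕ → Set
      InBlock m q = ∃[ z ] (start q ≤ z × z < edge q × m ≡ κ (base (r + r)) z)

      -- The integer bounds of block `j` in the definition of `phi`; block `j` corresponds to
      -- `q = r - j`.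
      lo hi : ℕ → ℤ
      lo j = + part c r ν (suc (r ∸ j)) ℤ.- + (2 * r) ℤ.+ 1ℤ ℤ.+ + j
      hi j = + part c r ν (r ∸ j) ℤ.- + (2 * r) ℤ.+ 1ℤ ℤ.+ + j

      block : ℕ → List Site
      block j = map (intMod (suc k)) (interval (lo j) (hi j))

      -- The parts decrease weakly, so the difference of the bounds is nonnegative and truncation at
      -- zero has no effect.
      length-block : ∀ j → ℤ.∣ (hi j ℤ.- lo j) ℤ.⊔ 0ℤ ∣ ≡ part c r ν (r ∸ j) ∸ part c r ν (suc (r ∸ j))
      length-block j = trans (cong (λ z → ℤ.∣ z ℤ.⊔ 0ℤ ∣)
          (trans (cong (λ x → shifted x ℤ.- lo j) (sym (ℕₚ.m+[n∸m]≡n (part-step (r ∸ j)))))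
          (cancel (+ part c r ν (suc (r ∸ j))) (+ d) (+ (2 * r)) (+ j)))) (nonneg d)
        where
        d = part c r ν (r ∸ j) ∸ part c r ν (suc (r ∸ j))
        shifted : ℕ → ℤ
        shifted x = + x ℤ.- + (2 * r) ℤ.+ 1ℤ ℤ.+ + j
        cancel : ∀ x d r j → ((x ℤ.+ d) ℤ.- r ℤ.+ 1ℤ ℤ.+ j) ℤ.- (x ℤ.- r ℤ.+ 1ℤ ℤ.+ j) ≡ d
        cancel = solve-∀
        nonneg : ∀ d → ℤ.∣ (+ d) ℤ.⊔ 0ℤ ∣ ≡ d
        nonneg zero    = refl
        nonneg (suc d) = refl

      site-block : ∀ j t → intMod (suc k) (lo j ℤ.+ + t) ≡ κ (base (r + r)) (part c r ν (suc (r ∸ j)) + j + t)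
      site-block j t = trans (sym (ι≡intMod _)) (cong ι (rearrange (+ part c r ν (suc (r ∸ j))) (+ j) (+ t) (+ r)))
        where
        rearrange : ∀ x j t r → (x ℤ.- (r ℤ.+ (r ℤ.+ 0ℤ)) ℤ.+ 1ℤ ℤ.+ j) ℤ.+ t ≡ (1ℤ ℤ.- (r ℤ.+ r)) ℤ.+ ((x ℤ.+ j) ℤ.+ t)
        rearrange = solve-∀

      phi⁻ : ∀ {m} → m ∈ₛ phi k c r ν → ∃[ q ] (q ≤ r × InBlock m q)
      phi⁻ {m} p with ∈-concat⁻′ (map block (upTo (suc r))) (toSubset⁻ (concat (map block (upTo (suc r)))) p)
      ... | b , m∈b , b∈ with ∈-map⁻ block b∈
      ...   | j , j∈ , refl with ∈-map⁻ (intMod (suc k)) m∈b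
      ...     | z , z∈ , refl with ∈-map⁻ (λ t → lo j ℤ.+ + t) z∈
      ...       | t , t∈ , refl = r ∸ j , ℕₚ.m∸n≤m r j , start (r ∸ j) + t , ℕₚ.m≤m+n _ t , below , eq
        where
        j≤r : j ≤ r
        j≤r = ℕₚ.≤-pred (∈-upTo⁻ j∈)
        t< : t < part c r ν (r ∸ j) ∸ part c r ν (suc (r ∸ j))
        t< = subst (t <_) (length-block j) (∈-upTo⁻ t∈)
        -- Truncated subtraction is undone here because `j ≤ r`; it turns the offset `j` of the
        -- block into the offset `r - q`.
        rr : r ∸ (r ∸ j) ≡ j
        rr = ℕₚ.m∸[m∸n]≡n j≤r
        eq : intMod (suc k) (lo j ℤ.+ + t) ≡ κ (base (r + r)) (start (r ∸ j) + t)
        eq = trans (site-block j t) (cong (λ x → κ (base (r + r)) (part c r ν (suc (r ∸ j)) + x + t)) (sym rr))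
        below : start (r ∸ j) + t < edge (r ∸ j)
        below = ℕₚ.<-≤-trans (ℕₚ.+-monoʳ-< (start (r ∸ j)) t<) (ℕₚ.≤-reflexive
          (trans (xy∙z≈xz∙y (part c r ν (suc (r ∸ j))) _ _) (cong (ℕ._+ (r ∸ (r ∸ j))) (ℕₚ.m+[n∸m]≡n (part-step (r ∸ j))))))

      phi⁺ : ∀ {m q} → q ≤ r → InBlock m q → m ∈ₛ phi k c r ν
      phi⁺ {m} {q} q≤r (z , lo≤z , z<hi , refl) = toSubset⁺ (concat (map block (upTo (suc r))))
        (∈-concat⁺′ (subst (_∈ block j) eq (∈-map⁺ (intMod (suc k)) (∈-map⁺ (λ t → lo j ℤ.+ + t) (∈-upTo⁺ t<))))
                    (∈-map⁺ block (∈-upTo⁺ (s≤s (ℕₚ.m∸n≤m r q)))))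
        where
        j = r ∸ q
        t = z ∸ start q
        rr : r ∸ j ≡ q
        rr = ℕₚ.m∸[m∸n]≡n q≤r
        eq : intMod (suc k) (lo j ℤ.+ + t) ≡ κ (base (r + r)) z
        eq = trans (site-block j t) (cong (κ (base (r + r)))
          (trans (cong (λ x → part c r ν (suc x) + j + t) rr) (ℕₚ.m+[n∸m]≡n lo≤z)))
        t< : t < ℤ.∣ (hi j ℤ.- lo j) ℤ.⊔ 0ℤ ∣
        t< = subst (t <_) (sym (trans (length-block j) (cong (λ x → part c r ν x ∸ part c r ν (suc x)) rr)))
          (subst (t <_) ([m+o]∸[n+o]≡m∸n (part c r ν q) (part c r ν (suc q)) j) (ℕₚ.∸-monoˡ-< z<hi lo≤z))

      -- A walk down the blocks from the top of the window. The hole `profile ν q` is also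
      -- `edge (suc q)`: a position above it lies in block `q`, one below it is left to the next
      -- block. The counter `d` is the number of blocks still to pass.
      locate : ∀ d q → q + d ≡ r → ∀ z → z < edge q →
               (∃[ i ] (i < r × z ≡ profile ν i)) ⊎ (∃[ q ] (q ≤ r × InBlock (κ (base (r + r)) z) q))
      locate zero q q≡r z z<e = inj₂ (q , ℕₚ.≤-reflexive q≡r′ , z ,
        subst (_≤ z) (sym (trans (cong start q≡r′) start-last)) z≤n , z<e , refl)
        where
        q≡r′ = trans (sym (ℕₚ.+-identityʳ q)) q≡r
      locate (suc d) q e z z<e with ℕₚ.<-cmp z (profile ν q)
      ... | tri< lt _ _ = locate d (suc q) (trans (sym (ℕₚ.+-suc q d)) e) z lt
      ... | tri≈ _ z≡ _ = inj₁ (q , q<r , z≡)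
        where
        q<r = subst (q <_) e (ℕₚ.m<m+n q (s≤s z≤n))
      ... | tri> _ _ gt = inj₂ (q , ℕₚ.<⇒≤ q<r , z , subst (_≤ z) (sym (start-suc q<r)) gt , z<e , refl)
        where
        q<r = subst (q <_) e (ℕₚ.m<m+n q (s≤s z≤n))

      -- By monotonicity of the profile, a hole with `i < q` is at or beyond the right end of block
      -- `q`, and one with `q ≤ i` is below its start.
      profile∉block : ∀ {i q} → i < r → q ≤ r → ¬ InBlock (κ (base (r + r)) (profile ν i)) q
      profile∉block {i} {q} i<r q≤r (z , lo≤z , z<hi , e) with ℕₚ.<-≤-connex i q
      ... | inj₁ (s≤s i≤q′) = ℕₚ.<⇒≱ (subst (_< edge q) z≡ z<hi) (Decreasing-≤ profile-dec i≤q′ q≤r)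
        where
        z≡ = sym (ι-injective (base (r + r)) (profile<n i<r) (ℕₚ.<-≤-trans z<hi (edge≤n q≤r)) e)
      ... | inj₂ q≤i = ℕₚ.<⇒≱ (subst₂ _≤_ (start-suc (ℕₚ.≤-<-trans q≤i i<r)) z≡ lo≤z) (Decreasing-≤ profile-dec q≤i i<r)
        where
        z≡ = sym (ι-injective (base (r + r)) (profile<n i<r) (ℕₚ.<-≤-trans z<hi (edge≤n q≤r)) e)

      phi-holes : Holes (lookup (phi k c r ν)) (base (r + r)) r (profile ν)
      phi-holes = record
        { hole = λ i<r → ∉⇒false (phi k c r ν) λ p → let q , q≤r , b = phi⁻ p in profile∉block i<r q≤r b
        ; only = only′ }
        where
        only′ : ∀ m → lookup (phi k c r ν) m ≡ false → ∃[ i ] (i < r × m ≡ κ (base (r + r)) (profile ν i))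
        only′ m f with ι-surjective (base (r + r)) m
        -- The walk starts at `q` = 0, where `edge 0` is c + r = k + 1 and bounds the whole window.
        ... | z , z<n , refl with locate r 0 refl z (subst (z <_) (sym c+r≡n) z<n)
        ...   | inj₁ (i , i<r , refl) = i , i<r , refl
        ...   | inj₂ (q , q≤r , b) = ⊥-elim (false⇒∉ (phi k c r ν) f (phi⁺ q≤r b))

      size-phi : ∣ phi k c r ν ∣ ≡ c
      size-phi = ∁-size {phi k c r ν} (Holes-size {phi k c r ν} phi-holes profile<n profile-dec)

    -- Equal subsets have equal hole sets. Both profiles list these holes decreasingly in the same
    -- window, so they coincide, and removing the staircase recovers the parts.
    phi-injective : ∀ {ν ν′} → InBox c r ν → InBox c r ν′ → phi k c r ν ≡ phi k c r ν′ → ν ≡ ν′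
    phi-injective {ν} {ν′} box box′ e = lookup-ext λ x →
      trans (sym (entry ν x)) (trans (ℕₚ.+-cancelʳ-≡ (r ∸ suc (toℕ x)) _ _
        (decreasing-unique P.profile-dec P′.profile-dec
          (transfer P.profile<n P′.profile<n P.phi-holes P′.phi-holes e)
          (transfer P′.profile<n P.profile<n P′.phi-holes P.phi-holes (sym e)) (toℕ x) (Finₚ.toℕ<n x)))
        (entry ν′ x))
      where
      module P  = Partition {ν} box
      module P′ = Partition {ν′} box′
      entry : ∀ (ν : Vec ℕ r) x → at (toList ν) (suc (toℕ x)) ≡ lookup ν x
      entry ν x = trans (at-toList ν (Finₚ.toℕ<n x)) (cong (lookup ν) (Finₚ.fromℕ<-toℕ x (Finₚ.toℕ<n x)))
      transfer : ∀ {D D′ g g′} → (∀ {i} → i < r → g i < suc k) → (∀ {i} → i < r → g′ i < suc k) →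
                 Holes (lookup D) (base (r + r)) r g → Holes (lookup D′) (base (r + r)) r g′ → D ≡ D′ →
                 ∀ {i} → i < r → ∃[ j ] (j < r × g i ≡ g′ j)
      transfer g<n g′<n H H′ refl i<r =
        let j , j<r , q = Holes.only H′ _ (Holes.hole H i<r) in
        j , j<r , ι-injective (base (r + r)) (g<n i<r) (g′<n j<r) q

    -- Surjectivity: the partition is read off the decreasing list of holes of `D`.

    module Preimage (D : Subset (suc k)) (size : ∣ D ∣ ≡ c) where

      B : ℤ
      B = base (r + r)

      P? = λ p → lookup D (κ B p) Bool.≟ false

      positions : List ℕ
      positions = filter P? (downFrom (suc k))

      descending : AllPairs ℕ._>_ positions
      descending = AllPairsₚ.filter⁺ P? (AllPairsₚ.applyDownFrom⁺₁ (λ i → i) (suc k) λ j<i _ → j<i)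

      positions< : ∀ {p} → p ∈ positions → p < suc k
      positions< p∈ = ∈-downFrom⁻ (proj₁ (∈-filter⁻ P? {xs = downFrom (suc k)} p∈))

      length-positions : length positions ≡ r
      length-positions = trans (sym (length-map (κ B) positions))
        (trans (unique-length (∁ D) (map (κ B) positions)
                  (unique-map (κ B) (λ p q → ι-injective B (positions< p) (positions< q))
                    (Uniqueₚ.filter⁺ P? (Uniqueₚ.downFrom⁺ (suc k))))
                  sound complete)
          (trans (∣∁p∣≡n∸∣p∣ D) (trans (cong₂ _∸_ (sym c+r≡n) size) (ℕₚ.m+n∸m≡n c r))))
        where
        sound : ∀ {m} → m ∈ map (κ B) positions → lookup (∁ D) m ≡ true
        sound p with ∈-map⁻ (κ B) p
        ... | y , y∈ , refl = []=⇒lookup (x∉p⇒x∈∁p (false⇒∉ D (proj₂ (∈-filter⁻ P? {xs = downFrom (suc k)} y∈))))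
        complete : ∀ m → lookup (∁ D) m ≡ true → m ∈ map (κ B) positions
        complete m e with ι-surjective B m
        ... | z , z<n , refl = ∈-map⁺ (κ B) (∈-filter⁺ P? (∈-downFrom⁺ z<n) (∉⇒false D (x∈∁p⇒x∉p (lookup⇒[]= _ (∁ D) e))))

      g : ℕ → ℕ
      g i = at positions (suc i)

      g∈ : ∀ {i} → i < r → g i ∈ positions
      g∈ i<r = at-∈ positions (subst (_ <_) (sym length-positions) i<r)

      g-dec : Decreasing r g
      g-dec i<j j<r = at-pairs descending i<j (subst (_ <_) (sym length-positions) j<r)

      s : ℕ → ℕ
      s i = r ∸ suc i

      -- There are `s i` further holes at distinct positions below hole `i`.
      g≥s : ∀ {i} → i < r → s i ≤ g i
      g≥s {i} i<r = ℕₚ.≤-trans (ℕₚ.m≤n+m (s i) _) (decreasing-gap g-dec i (s i)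
        (subst (i + s i <_) (ℕₚ.m+[n∸m]≡n i<r) ℕₚ.≤-refl))

      -- The first hole is at most k, and each later one is at least one lower.
      g≤c+s : ∀ {i} → i < r → g i ≤ c + s i
      g≤c+s {i} i<r = ℕₚ.+-cancelʳ-≤ (suc i) _ _ (begin
        g i + suc i       ≡⟨ ℕₚ.+-suc (g i) i ⟩
        suc (g i + i)     ≤⟨ s≤s (decreasing-gap g-dec 0 i i<r) ⟩
        suc (g 0)         ≤⟨ positions< (g∈ (ℕₚ.≤-<-trans z≤n i<r)) ⟩
        suc k             ≡⟨ c+r≡n ⟨
        c + r             ≡⟨ cong (ℕ._+_ c) (ℕₚ.m∸n+n≡m i<r) ⟨
        c + (s i + suc i) ≡⟨ ℕₚ.+-assoc c (s i) (suc i) ⟨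
        c + s i + suc i   ∎)
        where open ℕₚ.≤-Reasoning

      ν : Vec ℕ r
      ν = tabulate λ x → g (toℕ x) ∸ s (toℕ x)

      box : InBox c r ν
      box = (λ x → subst (_≤ c) (sym (lookup∘tabulate _ x))
              (ℕₚ.≤-trans (ℕₚ.∸-monoˡ-≤ (s (toℕ x)) (g≤c+s (Finₚ.toℕ<n x))) (ℕₚ.≤-reflexive (ℕₚ.m+n∸n≡m c (s (toℕ x)))))) ,
            (λ x y x≤y → subst₂ _≤_ (sym (lookup∘tabulate _ y)) (sym (lookup∘tabulate _ x))
              (weakly (toℕ x) (toℕ y ∸ toℕ x) (ℕₚ.m+[n∸m]≡n x≤y) (Finₚ.toℕ<n y)))
        where
        -- Over `d` steps the holes drop by at least `d` and the staircase by exactly `d`.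
        weakly : ∀ i d {j} → i + d ≡ j → j < r → g j ∸ s j ≤ g i ∸ s i
        weakly i d refl j<r = ℕₚ.≤-trans (ℕₚ.≤-reflexive (sym ([m+o]∸[n+o]≡m∸n (g (i + d)) (s (i + d)) d)))
          (ℕₚ.∸-mono (decreasing-gap g-dec i d j<r) (ℕₚ.≤-reflexive s≡))
          where
          s≡ : s i ≡ s (i + d) + d
          s≡ = ℕₚ.+-cancelʳ-≡ (suc i) _ _ (trans (ℕₚ.m∸n+n≡m (ℕₚ.≤-<-trans (ℕₚ.m≤m+n i d) j<r))
            (sym (trans (regroup (s (i + d)) d i) (ℕₚ.m∸n+n≡m j<r))))
            where
            regroup : ∀ a d i → a + d + suc i ≡ a + suc (i + d)
            regroup = ℕ-solve-∀

      profile≡g : ∀ {i} → i < r → profile ν i ≡ g i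
      profile≡g {i} i<r = trans (cong (ℕ._+ s i) (trans (at-toList ν i<r) (trans (lookup∘tabulate _ (fromℕ< i<r))
        (cong (λ i → g i ∸ s i) (Finₚ.toℕ-fromℕ< i<r))))) (ℕₚ.m∸n+n≡m (g≥s i<r))

      D-holes : Holes (lookup D) B r (profile ν)
      D-holes = record
        { hole = λ i<r → trans (cong (lookup D ∘ κ B) (profile≡g i<r)) (proj₂ (∈-filter⁻ P? {xs = downFrom (suc k)} (g∈ i<r)))
        ; only = only′ }
        where
        only′ : ∀ m → lookup D m ≡ false → ∃[ i ] (i < r × m ≡ κ B (profile ν i))
        only′ m f with ι-surjective B m
        ... | z , z<n , refl with ∈-at (∈-filter⁺ P? (∈-downFrom⁺ z<n) f)
        ...   | i , i<l , z≡ = let i<r = subst (i <_) length-positions i<l in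
                               i , i<r , cong (κ B) (trans z≡ (sym (profile≡g i<r)))

      phi≡ : phi k c r ν ≡ D
      phi≡ = lookup-ext (Holes-unique (Partition.phi-holes {ν} box) D-holes)

-- Coefficients in the free algebra.

pick : ∀ {n} → List (Fin n) → ℤ × List (Fin n) → ℤ
pick w (c , u) with ≡-dec _≟_ u w
... | yes _ = c
... | no _  = 0ℤ

-- Names the selector local to coeff, which depends on the whole combination f.
selector : ∀ {n} (f : FA n) w → ∃[ g ] (coeff f w ≡ sumℤ (map g f))
selector f w = _ , refl

selector≡pick : ∀ {n} (f : FA n) w → proj₁ (selector f w) ≗ pick w
selector≡pick f w (c , u) with ≡-dec _≟_ u w
... | yes _ = refl
... | no _  = refl

coeff-pick : ∀ {n} (f : FA n) w → coeff f w ≡ sumℤ (map (pick w) f)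
coeff-pick f w = trans (proj₂ (selector f w)) (cong sumℤ (map-cong (selector≡pick f w) f))

coeff-∷ : ∀ {n} a (f : FA n) w → coeff (a ∷ f) w ≡ coeff (a ∷ []) w ℤ.+ coeff f w
coeff-∷ a f w = trans (coeff-pick (a ∷ f) w) (sym (cong₂ ℤ._+_
  (trans (coeff-pick (a ∷ []) w) (ℤₚ.+-identityʳ (pick w a))) (coeff-pick f w)))

coeff-++ : ∀ {n} (f g : FA n) w → coeff (f ++ g) w ≡ coeff f w ℤ.+ coeff g w
coeff-++ []      g w = sym (ℤₚ.+-identityˡ _)
coeff-++ (a ∷ f) g w = begin
  coeff (a ∷ (f ++ g)) w                            ≡⟨ coeff-∷ a (f ++ g) w ⟩
  coeff (a ∷ []) w ℤ.+ coeff (f ++ g) w             ≡⟨ cong (ℤ._+_ (coeff (a ∷ []) w)) (coeff-++ f g w) ⟩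
  coeff (a ∷ []) w ℤ.+ (coeff f w ℤ.+ coeff g w)    ≡⟨ ℤₚ.+-assoc (coeff (a ∷ []) w) (coeff f w) (coeff g w) ⟨
  (coeff (a ∷ []) w ℤ.+ coeff f w) ℤ.+ coeff g w    ≡⟨ cong (ℤ._+ coeff g w) (coeff-∷ a f w) ⟨
  coeff (a ∷ f) w ℤ.+ coeff g w                     ∎
  where open ≡-Reasoning

coeff-neg : ∀ {n} (u w : List (Fin n)) → coeff ((-1ℤ , u) ∷ []) w ≡ ℤ.- coeff (mono u) w
coeff-neg u w with ≡-dec _≟_ u w
... | yes _ = refl
... | no _  = refl

coeff-↭ : ∀ {n} {xs ys : List (List (Fin n))} → xs ↭ ys → ∀ w → coeff (sumMonos xs) w ≡ coeff (sumMonos ys) w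
coeff-↭ ↭.refl w = refl
coeff-↭ (↭.prep {xs} {ys} x p) w = begin
  coeff ((1ℤ , x) ∷ sumMonos xs) w            ≡⟨ coeff-∷ (1ℤ , x) (sumMonos xs) w ⟩
  coeff (mono x) w ℤ.+ coeff (sumMonos xs) w  ≡⟨ cong (ℤ._+_ (coeff (mono x) w)) (coeff-↭ p w) ⟩
  coeff (mono x) w ℤ.+ coeff (sumMonos ys) w  ≡⟨ coeff-∷ (1ℤ , x) (sumMonos ys) w ⟨
  coeff ((1ℤ , x) ∷ sumMonos ys) w            ∎
  where open ≡-Reasoning
coeff-↭ (↭.swap {xs} {ys} x y p) w = begin
  coeff (sumMonos (x ∷ y ∷ xs)) w                                    ≡⟨ two x y xs ⟩
  coeff (mono x) w ℤ.+ (coeff (mono y) w ℤ.+ coeff (sumMonos xs) w)  ≡⟨ exchange (coeff (mono x) w) (coeff (mono y) w) _ ⟩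
  coeff (mono y) w ℤ.+ (coeff (mono x) w ℤ.+ coeff (sumMonos xs) w)  ≡⟨ cong (λ t → coeff (mono y) w ℤ.+ (coeff (mono x) w ℤ.+ t))
                                                                             (coeff-↭ p w) ⟩
  coeff (mono y) w ℤ.+ (coeff (mono x) w ℤ.+ coeff (sumMonos ys) w)  ≡⟨ two y x ys ⟨
  coeff (sumMonos (y ∷ x ∷ ys)) w                                    ∎
  where
  open ≡-Reasoning
  two : ∀ x y xs → coeff (sumMonos (x ∷ y ∷ xs)) w ≡ coeff (mono x) w ℤ.+ (coeff (mono y) w ℤ.+ coeff (sumMonos xs) w)
  two x y xs = trans (coeff-∷ (1ℤ , x) (sumMonos (y ∷ xs)) w)
    (cong (ℤ._+_ (coeff (mono x) w)) (coeff-∷ (1ℤ , y) (sumMonos xs) w))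
  exchange : ∀ a b c → a ℤ.+ (b ℤ.+ c) ≡ b ℤ.+ (a ℤ.+ c)
  exchange = solve-∀
coeff-↭ (↭.trans p q) w = trans (coeff-↭ p w) (coeff-↭ q w)

-- Passage to the affine nilCoxeter algebra and summation over ν.

module Algebra (k : ℕ) (1≤k : 1 ≤ k) where

  open Sites k
  open Exclusion k 1≤k
  open Parallel k 1≤k
  open Reading k 1≤k
  open Holey k 1≤k

  idealSum-++ : ∀ L M → idealSum {k} (L ++ M) ≡ idealSum L ++ idealSum M
  idealSum-++ L M = trans (cong concat (map-++ _ L M)) (sym (concat-++ (map _ L) (map _ M)))

  coeff≡⇒≈𝔸 : ∀ {f g : FA (suc k)} → (∀ w → coeff f w ≡ coeff g w) → f ≈𝔸 g
  coeff≡⇒≈𝔸 {f} {g} e = [] , λ w → trans (cong (ℤ._- coeff g w) (e w)) (ℤₚ.+-inverseʳ (coeff g w))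

  ≈𝔸-trans : ∀ {f g h : FA (suc k)} → f ≈𝔸 g → g ≈𝔸 h → f ≈𝔸 h
  ≈𝔸-trans {f} {g} {h} (L , p) (M , q) = L ++ M , λ w → begin
    coeff f w ℤ.- coeff h w                                      ≡⟨ telescope (coeff f w) (coeff g w) (coeff h w) ⟩
    (coeff f w ℤ.- coeff g w) ℤ.+ (coeff g w ℤ.- coeff h w)      ≡⟨ cong₂ ℤ._+_ (p w) (q w) ⟩
    coeff (idealSum L) w ℤ.+ coeff (idealSum M) w                ≡⟨ coeff-++ (idealSum L) (idealSum M) w ⟨
    coeff (idealSum L ++ idealSum M) w                           ≡⟨ cong (λ s → coeff s w) (idealSum-++ L M) ⟨
    coeff (idealSum (L ++ M)) w                                  ∎
    where
    open ≡-Reasoning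
    telescope : ∀ a b c → a ℤ.- c ≡ (a ℤ.- b) ℤ.+ (b ℤ.- c)
    telescope = solve-∀

  ≈𝔸-++ : ∀ {f f′ g g′ : FA (suc k)} → f ≈𝔸 g → f′ ≈𝔸 g′ → (f ++ f′) ≈𝔸 (g ++ g′)
  ≈𝔸-++ {f} {f′} {g} {g′} (L , p) (M , q) = L ++ M , λ w → begin
    coeff (f ++ f′) w ℤ.- coeff (g ++ g′) w                        ≡⟨ cong₂ ℤ._-_ (coeff-++ f f′ w) (coeff-++ g g′ w) ⟩
    (coeff f w ℤ.+ coeff f′ w) ℤ.- (coeff g w ℤ.+ coeff g′ w)      ≡⟨ regroup (coeff f w) (coeff f′ w) (coeff g w) (coeff g′ w) ⟩
    (coeff f w ℤ.- coeff g w) ℤ.+ (coeff f′ w ℤ.- coeff g′ w)      ≡⟨ cong₂ ℤ._+_ (p w) (q w) ⟩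
    coeff (idealSum L) w ℤ.+ coeff (idealSum M) w                  ≡⟨ coeff-++ (idealSum L) (idealSum M) w ⟨
    coeff (idealSum L ++ idealSum M) w                             ≡⟨ cong (λ s → coeff s w) (idealSum-++ L M) ⟨
    coeff (idealSum (L ++ M)) w                                    ∎
    where
    open ≡-Reasoning
    regroup : ∀ a b c d → (a ℤ.+ b) ℤ.- (c ℤ.+ d) ≡ (a ℤ.- c) ℤ.+ (b ℤ.- d)
    regroup = solve-∀

  Commute⇒≈𝔸 : ∀ {u v} → Commute u v → mono u ≈𝔸 mono v
  -- One ideal term suffices: the commutation relator multiplied by `p` on the left and `q` on the
  -- right.
  Commute⇒≈𝔸 (swap-at p q {i} {j} ¬adj) = (1ℤ , p , (_ , n-comm i j ¬adj) , q) ∷ [] , λ w → sym (begin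
    coeff ((1ℤ , p ++ i ∷ j ∷ q) ∷ (-1ℤ , p ++ j ∷ i ∷ q) ∷ []) w
      ≡⟨ coeff-∷ (1ℤ , p ++ i ∷ j ∷ q) ((-1ℤ , p ++ j ∷ i ∷ q) ∷ []) w ⟩
    coeff (mono (p ++ i ∷ j ∷ q)) w ℤ.+ coeff ((-1ℤ , p ++ j ∷ i ∷ q) ∷ []) w
      ≡⟨ cong (ℤ._+_ (coeff (mono (p ++ i ∷ j ∷ q)) w)) (coeff-neg (p ++ j ∷ i ∷ q) w) ⟩
    coeff (mono (p ++ i ∷ j ∷ q)) w ℤ.- coeff (mono (p ++ j ∷ i ∷ q)) w        ∎)
    where open ≡-Reasoning

  ≈c⇒≈𝔸 : ∀ {u v} → u ≈c v → mono u ≈𝔸 mono v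
  ≈c⇒≈𝔸 {u} ε                      = coeff≡⇒≈𝔸 {mono u} {mono u} λ _ → refl
  ≈c⇒≈𝔸 {u} {v} (_◅_ {j = x} s ss) = ≈𝔸-trans {mono u} {mono x} {mono v} (Commute⇒≈𝔸 s) (≈c⇒≈𝔸 ss)

  module Identity (c r : ℕ) (1≤r : 1 ≤ r) (c+r≡n : c + r ≡ suc k)
                  (σ : Subset (suc k) → Word) (σ-order : ∀ D → Proper D → IsUOrder (suc k) D (σ D)) where

    -- Adding r to the sites moves the base from 1 - 2r to 1 - r, so A + r has the same hole
    -- positions in the window where the reading word ends.
    shift-holes : ∀ {A h} → (∀ {i} → i < r → h i < suc k) → Holes (lookup A) (base (r + r)) r h →
                  Holes (lookup (shift (suc k) A r)) (base r) r h
    shift-holes {A} {h} h<n H = record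
      { hole = λ {i} i<r → trans (moved (h i)) (hole i<r)
      ; only = only′ }
      where
      open Holes H
      moved : ∀ p → lookup (shift (suc k) A r) (κ (base r) p) ≡ lookup A (κ (base (r + r)) p)
      moved p = trans (lookup-shift A r (κ (base r) p)) (cong (lookup A)
        (trans (ι-+ (base r ℤ.+ + p) (ℤ.- + r)) (cong ι (regroup (+ p) (+ r)))))
        where
        regroup : ∀ p r → ((1ℤ ℤ.- r) ℤ.+ p) ℤ.+ (ℤ.- r) ≡ (1ℤ ℤ.- (r ℤ.+ r)) ℤ.+ p
        regroup = solve-∀
      only′ : ∀ m → lookup (shift (suc k) A r) m ≡ false → ∃[ i ] (i < r × m ≡ κ (base r) (h i))
      only′ m f with ι-surjective (base r) m
      ... | z , z<n , refl with only (κ (base (r + r)) z) (trans (sym (moved z)) f)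
      ...   | i , i<r , e = i , i<r , cong (κ (base r)) (ι-injective (base (r + r)) z<n (h<n i<r) e)

    reduced≈vtilde : ∀ ν → InBox c r ν → ∀ x → IsReducedWordOf x (Vword k c r ν) →
                     mono x ≈𝔸 mono (vtilde k σ r (phi k c r ν))
    reduced≈vtilde ν box x red = ≈c⇒≈𝔸 (reduced≈c {lookup A} {x} {Vword k c r ν} {vtilde k σ r A} red
        (proj₁ V-run) (Runs.legal-run v-run)
        (λ m → trans (Holes-unique (proj₂ V-run) (shift-holes {A} profile<n phi-holes) m) (sym (Runs.final v-run m)))
        (trans length-Vword (trans (cong (ℕ._*_ r) (sym size-phi)) (sym (Runs.length-run v-run)))))
      where
      open Partition c r c+r≡n {ν} box
      A = phi k c r ν
      V-run = Vword-clears {lookup A} phi-holes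
      -- Since `1 ≤ r`, the set has c < k + 1 elements; its shifts are therefore proper and `σ`
      -- orders them.
      v-run = vtilde-runs σ σ-order A
        (subst (ℕ._< suc k) (sym size-phi) (subst (c <_) c+r≡n (ℕₚ.m<m+n c 1≤r))) r

    sum-reduced≈ : ∀ Lν → (∀ ν → ν ∈ Lν → InBox c r ν) → (ρ : Vec ℕ r → Word) →
                   (∀ ν → InBox c r ν → IsReducedWordOf (ρ ν) (Vword k c r ν)) →
                   sumMonos (map ρ Lν) ≈𝔸 sumMonos (map (vtilde k σ r) (map (phi k c r) Lν))
    sum-reduced≈ []       _     ρ red = coeff≡⇒≈𝔸 {[]} {[]} λ _ → refl
    sum-reduced≈ (ν ∷ Lν) boxes ρ red = ≈𝔸-++ {mono (ρ ν)} {sumMonos (map ρ Lν)} {mono (vtilde k σ r (phi k c r ν))}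
      {sumMonos (map (vtilde k σ r) (map (phi k c r) Lν))}
      (reduced≈vtilde ν (boxes ν (here refl)) (ρ ν) (red ν (boxes ν (here refl))))
      (sum-reduced≈ Lν (λ ν → boxes ν ∘ there) ρ red)

    -- This reindexes the sum: injectivity keeps the image list free of repetitions, the size of
    -- φ(ν) puts it inside `LA`, and `Preimage` shows that it is all of `LA`.
    phi-↭ : ∀ {Lν LA} → Unique Lν → (∀ ν → (ν ∈ Lν → InBox c r ν) × (InBox c r ν → ν ∈ Lν)) →
            Unique LA → (∀ A → (A ∈ LA → ∣ A ∣ ≡ c) × (∣ A ∣ ≡ c → A ∈ LA)) → map (phi k c r) Lν ↭ LA
    phi-↭ {Lν} {LA} uν memν uA memA = unique-↭
      (unique-map (phi k c r) (λ {ν} {ν′} p q → phi-injective c r c+r≡n {ν} {ν′} (proj₁ (memν ν) p) (proj₁ (memν ν′) q)) uν) uA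
      to (λ {A} → from A)
      where
      to : ∀ {A} → A ∈ map (phi k c r) Lν → A ∈ LA
      to p with ∈-map⁻ (phi k c r) p
      ... | ν , ν∈ , refl = proj₂ (memA _) (Partition.size-phi c r c+r≡n {ν} (proj₁ (memν ν) ν∈))
      from : ∀ A → A ∈ LA → A ∈ map (phi k c r) Lν
      from A p = subst (_∈ map (phi k c r) Lν) phi≡ (∈-map⁺ (phi k c r) (proj₂ (memν ν) box))
        where
        open Preimage c r c+r≡n A (proj₁ (memA A) p)

    sum-identity : (Lν : List (Vec ℕ r)) → Unique Lν → (∀ ν → (ν ∈ Lν → InBox c r ν) × (InBox c r ν → ν ∈ Lν)) →
      (ρ : Vec ℕ r → Word) → (∀ ν → InBox c r ν → IsReducedWordOf (ρ ν) (Vword k c r ν)) →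
      (LA : List (Subset (suc k))) → Unique LA → (∀ A → (A ∈ LA → ∣ A ∣ ≡ c) × (∣ A ∣ ≡ c → A ∈ LA)) →
      sumMonos (map ρ Lν) ≈𝔸 sumMonos (map (vtilde k σ r) LA)
    sum-identity Lν uν memν ρ red LA uA memA =
      ≈𝔸-trans {sumMonos (map ρ Lν)} {sumMonos (map (vtilde k σ r) (map (phi k c r) Lν))} {sumMonos (map (vtilde k σ r) LA)}
        (sum-reduced≈ Lν (λ ν → proj₁ (memν ν)) ρ red)
        (coeff≡⇒≈𝔸 {sumMonos (map (vtilde k σ r) (map (phi k c r) Lν))} {sumMonos (map (vtilde k σ r) LA)}
          (coeff-↭ (↭-map⁺ (vtilde k σ r) (phi-↭ uν memν uA memA))))

theorem3p11 : (k c r : ℕ) → 1 ≤ k → 1 ≤ c → 1 ≤ r → c + r ≡ suc k →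
    (σ : Subset (suc k) → List (Fin (suc k))) →
    (∀ D → Proper D → IsUOrder (suc k) D (σ D)) →
    ((ν : Vec ℕ r) → InBox c r ν →
    (x : List (Fin (suc k))) → IsReducedWordOf x (Vword k c r ν) →
    mono x ≈𝔸 mono (vtilde k σ r (phi k c r ν)))
    ×
    ((Lν : List (Vec ℕ r)) → Unique Lν → (∀ ν → (ν ∈ Lν → InBox c r ν) × (InBox c r ν → ν ∈ Lν)) →
    (ρ : Vec ℕ r → List (Fin (suc k))) →
    (∀ ν → InBox c r ν → IsReducedWordOf (ρ ν) (Vword k c r ν)) →
    (LA : List (Subset (suc k))) → Unique LA → (∀ A → (A ∈ LA → ∣ A ∣ ≡ c) × (∣ A ∣ ≡ c → A ∈ LA)) →
    sumMonos (map ρ Lν) ≈𝔸 sumMonos (map (vtilde k σ r) LA))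
theorem3p11 k c r 1≤k _ 1≤r c+r≡n σ σ-order = reduced≈vtilde , sum-identity
  where
  open Algebra k 1≤k
  open Identity c r 1≤r c+r≡n σ σ-order
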